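{- Let $G$ be a bipartite matching covered graph. Then $G\in\mathfrak{B}$ if and only if $G$ is (isomorphic to) one of $K_2^*$, $C_4^2$, $C_4^4$, $K_{3,3}$, or an even cycle $C_{2n}$ ($n\ge 2$).
   Context: Graphs are finite, loopless, and may have parallel edges (parallel edges are distinct edges, so perfect matchings differing only by the choice of a parallel edge are different). An edge is a $k$-matching edge if it belongs to exactly $k$ perfect matchings of the graph. A connected graph is matching covered if every edge belongs to at least one perfect matching. $\mathfrak{B}$ is the class of connected graphs (admitting a perfect matching) in which every edge is either a $1$-matching edge or a $2$-matching edge, and no perfect matching contains both a $1$-matching edge and a $2$-matching edge. $K_2^*$ denotes any graph on two vertices with one or more parallel edges joining them. $C_{2n}$ is the cycle with $2n$ vertices. $C_4^2$ is the graph obtained from the $4$-cycle by doubling (i.e. giving multiplicity $2$ to) each of two opposite (nonadjacent) edges; it is $3$-regular. $C_4^4$ is the graph obtained from the $4$-cycle by doubling every edge; it is $4$-regular. $K_{3,3}$ is the complete bipartite graph. -}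

module Defs where

open import Data.Bool using (Bool)
open import Data.Fin using (Fin; zero; suc; toℕ; _↑ˡ_; _↑ʳ_; remQuot)
open import Data.Fin.Patterns using (0F; 1F; 2F; 3F)
open import Data.Fin.Properties using (_≟_; all?; toℕ<n; toℕ-fromℕ<; suc-injective)
open import Data.Fin.Subset using (Subset; _∈_)
open import Data.List using (List; length)
import Data.List.Membership.Propositional as List
open import Data.List.Relation.Unary.Unique.Propositional using (Unique)
open import Data.Nat using (ℕ; suc; _+_; _*_; _≤_; z≤n; s≤s; NonZero; >-nonZero)
open import Data.Nat.DivMod using (_mod_; _%_; m<n⇒m%n≡m; n%n≡0; m%n<n)
open import Data.Nat.Properties using (≤-trans; m≤m+n; m≤n⇒m<n∨m≡n; 1+n≢n)
open import Data.Product using (∃; ∃!; _×_; _,_; proj₁; proj₂)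
open import Data.Sum using (_⊎_; inj₁; inj₂)
open import Data.Vec using ([]; _∷_; lookup)
open import Function.Bundles using (_⇔_; _↔_; Inverse)
open import Relation.Binary.Construct.Closure.ReflexiveTransitive using (Star)
open import Relation.Binary.PropositionalEquality using (_≡_; _≢_; refl; sym; trans; cong; subst)
open import Relation.Nullary using (¬_; ¬?; from-yes)

-- Edges have their own identity, so parallel edges are distinct elements of
-- Fin nE.  The order of the two ends of an edge carries no meaning: the
-- notions below use the ends only through Incident, Joins or symmetrically.
record Multigraph : Set where
  field
    nV nE    : ℕ
    ends     : Fin nE → Fin nV × Fin nV
    loopless : ∀ e → proj₁ (ends e) ≢ proj₂ (ends e)

open Multigraph public

Vertex Edge : Multigraph → Set
Vertex G = Fin (nV G)
Edge   G = Fin (nE G)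

Incident : (G : Multigraph) → Vertex G → Edge G → Set
Incident G v e = v ≡ proj₁ (ends G e) ⊎ v ≡ proj₂ (ends G e)

Joins : (G : Multigraph) → Edge G → Vertex G → Vertex G → Set
Joins G e u v = ends G e ≡ (u , v) ⊎ ends G e ≡ (v , u)

record _≅_ (G H : Multigraph) : Set where
  field
    onVertices : Vertex G ↔ Vertex H
    onEdges    : Edge G ↔ Edge H
    incidence  : ∀ v e →
                 Incident G v e ⇔ Incident H (Inverse.to onVertices v) (Inverse.to onEdges e)

infix 4 _≅_

-- The graph with no vertices does not count as connected.
Connected : Multigraph → Set
Connected G = Vertex G × (∀ u v → Star (λ x y → ∃ λ e → Joins G e x y) u v)

Bipartite : Multigraph → Set
Bipartite G = ∃ λ (side : Vertex G → Bool) →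
  ∀ e → side (proj₁ (ends G e)) ≢ side (proj₂ (ends G e))

PerfectMatching : (G : Multigraph) → Subset (nE G) → Set
PerfectMatching G M = ∀ v → ∃! _≡_ λ e → e ∈ M × Incident G v e

-- The perfect matchings containing e can be listed without repetition as a
-- list of length k.
MatchingEdge : (k : ℕ) (G : Multigraph) → Edge G → Set
MatchingEdge k G e = ∃ λ (Ms : List (Subset (nE G))) →
  length Ms ≡ k × Unique Ms ×
  (∀ M → M List.∈ Ms ⇔ (PerfectMatching G M × e ∈ M))

MatchingCovered : Multigraph → Set
MatchingCovered G = Connected G × (∀ e → ∃ λ M → PerfectMatching G M × e ∈ M)

record 𝔅 (G : Multigraph) : Set where
  field
    connected          : Connected G
    hasPerfectMatching : ∃ (PerfectMatching G)
    oneOrTwo           : ∀ e → MatchingEdge 1 G e ⊎ MatchingEdge 2 G e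
    noMixing           : ∀ M → PerfectMatching G M →
                         ¬ (∃ λ e → ∃ λ f → e ∈ M × f ∈ M ×
                            MatchingEdge 1 G e × MatchingEdge 2 G f)

-- Two vertices joined by m parallel edges.
K₂* : (m : ℕ) → Multigraph
K₂* m = record { nV = 2 ; nE = m ; ends = λ _ → 0F , 1F ; loopless = λ _ () }

C₄² : Multigraph
C₄² = record
  { nV       = 4
  ; nE       = 6
  ; ends     = ends′
  ; loopless = from-yes (all? λ e → ¬? (proj₁ (ends′ e) ≟ proj₂ (ends′ e)))
  }
  where
  ends′ : Fin 6 → Fin 4 × Fin 4
  ends′ = lookup ( (0F , 1F) ∷ (0F , 1F)
                 ∷ (1F , 2F)
                 ∷ (2F , 3F) ∷ (2F , 3F)
                 ∷ (3F , 0F) ∷ [])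

C₄⁴ : Multigraph
C₄⁴ = record
  { nV       = 4
  ; nE       = 8
  ; ends     = ends′
  ; loopless = from-yes (all? λ e → ¬? (proj₁ (ends′ e) ≟ proj₂ (ends′ e)))
  }
  where
  ends′ : Fin 8 → Fin 4 × Fin 4
  ends′ = lookup ( (0F , 1F) ∷ (0F , 1F)
                 ∷ (1F , 2F) ∷ (1F , 2F)
                 ∷ (2F , 3F) ∷ (2F , 3F)
                 ∷ (3F , 0F) ∷ (3F , 0F) ∷ [])

↑ˡ≢↑ʳ : ∀ {a b} (i : Fin a) (j : Fin b) → i ↑ˡ b ≢ a ↑ʳ j
↑ˡ≢↑ʳ {suc a} zero    j ()
↑ˡ≢↑ʳ {suc a} (suc i) j eq = ↑ˡ≢↑ʳ i j (suc-injective eq)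

-- The complete bipartite graph: remQuot identifies the a * b edges with the
-- pairs in Fin a × Fin b.
K : (a b : ℕ) → Multigraph
K a b = record
  { nV       = a + b
  ; nE       = a * b
  ; ends     = λ e → let (i , j) = remQuot {a} b e in i ↑ˡ b , a ↑ʳ j
  ; loopless = λ e → let (i , j) = remQuot {a} b e in ↑ˡ≢↑ʳ i j
  }

next : ∀ {k} → .{{NonZero k}} → Fin k → Fin k
next {k} i = suc (toℕ i) mod k

next-≢ : ∀ {k} .{{_ : NonZero k}} → 2 ≤ k → (i : Fin k) → i ≢ next i
next-≢ {k} 2≤k i i≡next with m≤n⇒m<n∨m≡n (toℕ<n i)
... | inj₁ 1+i<k = 1+n≢n (sym (trans toℕi≡ (m<n⇒m%n≡m 1+i<k)))
  where
  toℕi≡ : toℕ i ≡ suc (toℕ i) % k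
  toℕi≡ = trans (cong toℕ i≡next) (toℕ-fromℕ< (m%n<n (suc (toℕ i)) k))
... | inj₂ 1+i≡k = absurd (subst (2 ≤_) (trans (sym 1+i≡k) (cong suc i≡0)) 2≤k)
  where
  absurd : ¬ (2 ≤ 1)
  absurd (s≤s ())
  i≡0 : toℕ i ≡ 0
  i≡0 = trans (cong toℕ i≡next)
       (trans (toℕ-fromℕ< (m%n<n (suc (toℕ i)) k))
       (trans (cong (_% k) 1+i≡k) (n%n≡0 k)))

-- Edge i joins vertex i to vertex i + 1 modulo k.
Cycle : (k : ℕ) → 2 ≤ k → Multigraph
Cycle k 2≤k = record
  { nV       = k
  ; nE       = k
  ; ends     = λ i → i , next i
  ; loopless = next-≢ 2≤k
  }
  where
  instance
    k≢0 : NonZero k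
    k≢0 = >-nonZero (≤-trans (s≤s z≤n) 2≤k)

EvenCycle : (n : ℕ) → 2 ≤ n → Multigraph
EvenCycle n 2≤n = Cycle (2 * n) (≤-trans 2≤n (m≤m+n n (n + 0)))

{-# OPTIONS --safe #-}

-- Fix a perfect matching m and contract its edges.  Orienting every other edge
-- from the first colour class to the second turns G into a strongly connected
-- digraph D whose families of disjoint directed cycles are the perfect
-- matchings other than m.  The one tool is that a nonempty set of vertices
-- either contains a directed cycle or has a vertex all of whose arcs leave the
-- set.
--
-- If m consists of 1-matching edges, D − v is acyclic for every v, so the tool
-- gives a vertex with arcs to v only: D is a directed cycle with multiplicities,
-- and counting matchings leaves the even cycles and C₄².
--
-- Otherwise all edges are 2-matching edges.  Two vertices give C₄⁴.  With more,
-- G has no parallel edges, D − x has a single cycle family alt x, and for c on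
-- it D − x − c is acyclic, so there is a vertex with arcs into {x, c} only.
-- Counting matchings vertex by vertex makes G 3-regular.  Each alt x is then a
-- 2-cycle, any two of these meet, and three of them close up to K₃₃.
module Submission where

open import Defs
open import Data.Bool using (Bool; true; false)
open import Data.Bool.Properties using () renaming (_≟_ to _≟ᵇ_)
open import Data.Empty using (⊥; ⊥-elim)
open import Data.Fin
  using (Fin; zero; suc; toℕ; fromℕ<; _↑ˡ_; _↑ʳ_; splitAt; join; combine; remQuot)
open import Data.Fin.Patterns using (0F; 1F; 2F; 3F; 4F; 5F)
open import Data.Fin.Properties
  using (_≟_; any?; all?; pigeonhole; injective⇒≤; toℕ<n; toℕ-fromℕ<; toℕ-injective; splitAt-↑ˡ;
        splitAt-↑ʳ; join-splitAt; combine-injective; combine-remQuot; remQuot-combine)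
open import Data.Fin.Subset using (Subset; _∈_; inside; outside)
open import Data.Fin.Subset.Properties using (⊆-antisym; _∈?_)
open import Data.List as List using (List; []; _∷_; _++_; length; map; filter; allFin)
open import Data.List.Membership.Propositional using () renaming (_∈_ to _∈ˡ_)
open import Data.List.Membership.Propositional.Properties
  using (∈-lookup; ∈-allFin; ∈-map⁺; ∈-map⁻; ∈-++⁺ˡ; ∈-++⁺ʳ; ∈-filter⁺; ∈-filter⁻)
open import Data.List.Properties using (length-map)
open import Data.List.Relation.Unary.All as All using (All; []; _∷_)
open import Data.List.Relation.Unary.AllPairs using ([]; _∷_)
open import Data.List.Relation.Unary.Any using (here; there; index)
open import Data.List.Relation.Unary.Any.Properties using (lookup-index)
open import Data.List.Relation.Unary.Unique.Propositional using (Unique)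
open import Data.List.Relation.Unary.Unique.Propositional.Properties
  using (allFin⁺; map⁺; ++⁺; filter⁺)
open import Data.Nat as ℕ using (ℕ; zero; suc; _+_; _*_; _≤_; _<_; s≤s; z≤n; NonZero; >-nonZero)
open import Data.Nat.DivMod using (_%_; m<n⇒m%n≡m; n%n≡0; m%n<n)
open import Data.Nat.GeneralisedArithmetic using (fold; fold-+)
open import Data.Nat.Induction using (<-wellFounded)
open import Data.Nat.Properties
  using (+-comm; +-suc; ≤-trans; <-trans; <-cmp; <⇒≢; n<1+n; m≤m+n; m≤n+m; m≤n⇒m<n∨m≡n;
        m≤n⇒∃[o]m+o≡n; suc-injective; *-cancelʳ-≤; anyUpTo?)
open import Data.Product using (∃; ∃!; _×_; _,_; proj₁; proj₂)
open import Data.Sum as Sum using (_⊎_; inj₁; inj₂; [_,_]′)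
open import Data.Sum.Properties using (inj₁-injective; inj₂-injective; ≡-dec)
open import Data.Vec as Vec using ([]; _∷_; tabulate)
open import Data.Vec.Functional using (updateAt)
open import Data.Vec.Functional.Properties using (updateAt-updates; updateAt-minimal)
open import Data.Vec.Properties using (lookup⇒[]=; []=⇒lookup; lookup∘tabulate; ∷-injectiveʳ)
open import Function using (_∘_; const; case_of_; Injective; Inverse; Equivalence; mk⇔; mk↔ₛ′)
open import Function.Bundles using (_⇔_; _↔_)
open import Function.Properties.Inverse using (↔-sym)
open import Induction.WellFounded using (Acc; acc)
open import Relation.Binary.Construct.Closure.ReflexiveTransitive as Star using (Star; _◅_)
open import Relation.Binary.Definitions using (tri<; tri≈; tri>)
open import Relation.Binary.PropositionalEquality
open import Relation.Nullary
  using (¬_; Dec; yes; no; does; ¬?; contradiction; _×-dec_; _⊎-dec_; _→-dec_; from-yes)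
open import Relation.Nullary.Decidable using (decidable-stable; dec-true; map′)
open import Relation.Unary using (Decidable)

-- Strong connectivity of D is where the covering hypothesis enters: every edge outside m lies in a
-- matching, hence on a directed cycle (possibly a loop), so a set closed under arcs is also closed
-- under reversed arcs, and connectedness does the rest. The bound on degrees is a double count. If
-- each edge lies in two matchings, every degree is half the number of matchings, so one vertex with
-- few edges, the sink, bounds all of them. The sink has few edges only if it sends at most one to
-- each of its two targets; parallel edges must therefore be excluded first, and they are the main
-- obstacle. An edge parallel to one of m becomes a loop of D, and exchanging the two gives a second
-- matching agreeing with m at all other vertices, which leaves too little room for a third. To make
-- this apply to any parallel pair, m stays arbitrary there: a matching through one edge of the pair
-- is contracted. In the converse, `C₄²`, `C₄⁴` and `K 3 3` are settled by enumerating sets of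
-- edges; in `K₂*` and in cycles one edge determines its matching.

module _ {a} {A : Set a} (g : A → A) where

  fold-comm : ∀ x i j → fold (fold x g i) g j ≡ fold (fold x g j) g i
  fold-comm x i j = trans (sym (fold-+ x g j)) (trans (cong (fold x g) (+-comm j i)) (fold-+ x g i))

  fold-injective : (∀ {x y} → g x ≡ g y → x ≡ y) → ∀ k {x y} → fold x g k ≡ fold y g k → x ≡ y
  fold-injective inj zero    eq = eq
  fold-injective inj (suc k) eq = fold-injective inj k (inj eq)

  fold-invariant : ∀ {p} (P : A → Set p) → (∀ {x} → P x → P (g x)) → ∀ {x} k → P x → P (fold x g k)
  fold-invariant P step zero    px = px
  fold-invariant P step (suc k) px = step (fold-invariant P step k px)

-- Periodic orbits and permutations of finite sets.

module Orbit {a} {A : Set a} (g : A → A) (x : A) (k : ℕ) (returns : fold x g (suc k) ≡ x) where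

  On : A → Set a
  On y = ∃ λ j → j < suc k × fold x g j ≡ y

  on-start : On x
  on-start = 0 , s≤s z≤n , refl

  on-step : ∀ {y} → On y → On (g y)
  on-step (j , j<K , refl) with m≤n⇒m<n∨m≡n j<K
  ... | inj₁ lt = suc j , lt , refl
  ... | inj₂ eq = 0 , s≤s z≤n , sym (trans (cong (fold x g) eq) returns)

  on-returns : ∀ {y} → On y → fold y g (suc k) ≡ y
  on-returns (j , _ , refl) = trans (fold-comm g x j (suc k)) (cong (λ z → fold z g j) returns)

  -- On a periodic orbit `k` further steps undo `g`, even if `g` is not injective elsewhere. This is
  -- what makes an arbitrary choice of arcs injective along its cycle.
  on-inverse : ∀ {y} → On y → fold (g y) g k ≡ y
  on-inverse {y} o = trans (fold-comm g y 1 k) (on-returns o)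

  on-back : (∀ {y z} → g y ≡ g z → y ≡ z) → ∀ {y} → On (g y) → On y
  on-back inj {y} o = subst On (inj (on-returns o)) (fold-invariant g On on-step k o)

module _ {n} (g : Fin n → Fin n) where

  opaque
    eventually-periodic : ∀ x → ∃ λ i → ∃ λ k → fold (fold x g i) g (suc k) ≡ fold x g i
    eventually-periodic x
      with i , j , i<j , eq ← pigeonhole (n<1+n n) (λ i → fold x g (toℕ i))
      with d , 1+i+d≡j ← m≤n⇒∃[o]m+o≡n i<j
      = toℕ i , d , trans (sym (fold-+ x g (suc d)))
                   (trans (cong (fold x g) (trans (cong suc (+-comm d (toℕ i))) 1+i+d≡j)) (sym eq))

  module _ (g-injective : ∀ {x y} → g x ≡ g y → x ≡ y) where

    opaque
      periodic : ∀ x → ∃ λ k → fold x g (suc k) ≡ x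
      periodic x with i , k , eq ← eventually-periodic x
        = k , fold-injective g g-injective i (trans (fold-comm g x (suc k) i) eq)

    injective⇒surjective : ∀ y → ∃ λ x → g x ≡ y
    injective⇒surjective y with k , eq ← periodic y = fold y g k , eq

    -- A permutation of a finite set returns to `x`, so `x` is itself an iterate of `g x`.
    invariant-reverse : ∀ {p} (P : Fin n → Set p) → (∀ {x} → P x → P (g x)) → ∀ {x} → P (g x) → P x
    invariant-reverse P step {x} pgx with k , eq ← periodic x =
      subst P (trans (fold-comm g x 1 k) eq) (fold-invariant g P step k pgx)

-- Perfect matchings as selections, and contraction of a matching.

-- Both colour classes are Fin n; edge e joins vertex tail e of the first class
-- to vertex head e of the second.  A perfect matching is then a choice of an
-- edge at each vertex of the first class, injective on heads.
module Selections {n ε : ℕ} (tail head : Fin ε → Fin n) where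

  record Selection (f : Fin n → Fin ε) : Set where
    constructor selection
    field
      tail-at        : ∀ v → tail (f v) ≡ v
      head-injective : ∀ {u v} → head (f u) ≡ head (f v) → u ≡ v

  open Selection public

  infix 4 _∈ₛ_
  _∈ₛ_ : Fin ε → (Fin n → Fin ε) → Set
  e ∈ₛ f = f (tail e) ≡ e

  ∈ₛ-self : ∀ {f} → Selection f → ∀ v → f v ∈ₛ f
  ∈ₛ-self {f} F v = cong f (tail-at F v)

  replace : (Fin n → Fin ε) → Fin n → Fin ε → Fin n → Fin ε
  replace f v e = updateAt f v (const e)

  replace-at : ∀ f v e → replace f v e v ≡ e
  replace-at f v e = updateAt-updates v f

  replace-off : ∀ f v e {u} → u ≢ v → replace f v e u ≡ f u
  replace-off f v e {u} u≢v = updateAt-minimal u v f u≢v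

  replace-parallel : ∀ {f} → Selection f → ∀ {v e} → tail e ≡ v → head e ≡ head (f v) →
                     Selection (replace f v e)
  replace-parallel {f} F {v} {e} te he = selection tails heads
    where
    tails : ∀ u → tail (replace f v e u) ≡ u
    tails u with u ≟ v
    ... | yes refl = trans (cong tail (replace-at f u e)) te
    ... | no u≢v   = trans (cong tail (replace-off f v e u≢v)) (tail-at F u)
    same : ∀ u → head (replace f v e u) ≡ head (f u)
    same u with u ≟ v
    ... | yes refl = trans (cong head (replace-at f u e)) he
    ... | no u≢v   = cong head (replace-off f v e u≢v)
    heads : ∀ {u w} → head (replace f v e u) ≡ head (replace f v e w) → u ≡ w
    heads {u} {w} eq = head-injective F (trans (sym (same u)) (trans eq (same w)))

  -- Contracting the edges of m turns every other edge into an arc from its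
  -- tail to its target, and the selections other than m into the nonempty
  -- unions of disjoint directed cycles.
  module Contract (m : Fin n → Fin ε) (M : Selection m) where

    opaque
      tgt : Fin ε → Fin n
      tgt e = proj₁ (injective⇒surjective (head ∘ m) (head-injective M) (head e))

      head-tgt : ∀ e → head (m (tgt e)) ≡ head e
      head-tgt e = proj₂ (injective⇒surjective (head ∘ m) (head-injective M) (head e))

    tgt≡⇒head≡ : ∀ {e e′} → tgt e ≡ tgt e′ → head e ≡ head e′
    tgt≡⇒head≡ {e} {e′} eq = trans (sym (head-tgt e)) (trans (cong (head ∘ m) eq) (head-tgt e′))

    head≡⇒tgt≡ : ∀ {e e′} → head e ≡ head e′ → tgt e ≡ tgt e′
    head≡⇒tgt≡ {e} {e′} eq = head-injective M (trans (head-tgt e) (trans eq (sym (head-tgt e′))))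

    tgt-m : ∀ v → tgt (m v) ≡ v
    tgt-m v = head-injective M (head-tgt (m v))

    tgt-injective : ∀ {f} → Selection f → ∀ {u v} → tgt (f u) ≡ tgt (f v) → u ≡ v
    tgt-injective F = head-injective F ∘ tgt≡⇒head≡

    fromTgt : ∀ {f} → (∀ v → tail (f v) ≡ v) → (∀ {u v} → tgt (f u) ≡ tgt (f v) → u ≡ v) → Selection f
    fromTgt t i = selection t (i ∘ head≡⇒tgt≡)

    module _ {P : Fin n → Set} (P? : Decidable P) where

      private
        Stays : Fin n → Fin ε → Set
        Stays u e = tail e ≡ u × e ≢ m u × P (tgt e)

        stays? : ∀ u → Dec (∃ (Stays u))
        stays? u = any? λ e → (tail e ≟ u) ×-dec ¬? (e ≟ m u) ×-dec P? (tgt e)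

      opaque
        -- If every vertex of `P` has an arc staying in `P`, following such arcs ends in a directed
        -- cycle, and switching `m` along that cycle gives `f`.
        cycle-or-sink : ∃ P →
          (∃ λ f → Selection f × (∃ λ v → f v ≢ m v) × (∀ v → ¬ P v → f v ≡ m v)) ⊎
          (∃ λ u → P u × (∀ {e} → tail e ≡ u → e ≢ m u → ¬ P (tgt e)))
        cycle-or-sink (x , px) with any? (λ u → P? u ×-dec ¬? (stays? u))
        ... | yes (u , pu , none) = inj₂ (u , pu , λ t ne p → none (_ , t , ne , p))
        ... | no nosink = inj₁ (f , fromTgt f-tail f-tgt-inj , (w , f≢m) , f-off)
          where
          step : ∀ v → ∃ λ e → tail e ≡ v × (P v → e ≢ m v × P (tgt e))
          step v with P? v
          -- A dummy value that keeps the choice total; the walk from `x` never leaves `P`.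
          ... | no ¬pv = m v , tail-at M v , λ pv → contradiction pv ¬pv
          ... | yes pv with e , t , ne , p ← decidable-stable (stays? v) (λ none → nosink (v , pv , none))
            = e , t , λ _ → ne , p

          h : Fin n → Fin ε
          h v = proj₁ (step v)

          g : Fin n → Fin n
          g v = tgt (h v)

          P-step : ∀ {v} → P v → P (g v)
          P-step {v} pv = proj₂ (proj₂ (proj₂ (step v)) pv)

          i k : ℕ
          i = proj₁ (eventually-periodic g x)
          k = proj₁ (proj₂ (eventually-periodic g x))

          w : Fin n
          w = fold x g i

          returns : fold w g (suc k) ≡ w
          returns = proj₂ (proj₂ (eventually-periodic g x))

          pw : P w
          pw = fold-invariant g P P-step i px

          open Orbit g w k returns renaming (On to O)

          O? : Decidable O
          O? v = anyUpTo? (λ j → fold w g j ≟ v) (suc k)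

          O⇒P : ∀ {v} → O v → P v
          O⇒P (j , _ , refl) = fold-invariant g P P-step j pw

          pick : ∀ {v} → Dec (O v) → Fin ε
          pick {v} (yes _) = h v
          pick {v} (no _)  = m v

          f : Fin n → Fin ε
          f v = pick (O? v)

          f-tail : ∀ v → tail (f v) ≡ v
          f-tail v with O? v
          ... | yes _ = proj₁ (proj₂ (step v))
          ... | no _  = tail-at M v

          f-tgt-inj : ∀ {u v} → tgt (f u) ≡ tgt (f v) → u ≡ v
          f-tgt-inj {u} {v} eq with O? u | O? v
          ... | yes ou | yes ov = trans (sym (on-inverse ou)) (trans (cong (λ z → fold z g k) eq) (on-inverse ov))
          -- Arcs of the cycle end on the cycle, and off it `m` leads each vertex to itself, so a
          -- target on the cycle never equals one off it.
          ... | yes ou | no ¬ov = contradiction (subst O (trans eq (tgt-m v)) (on-step ou)) ¬ov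
          ... | no ¬ou | yes ov = contradiction (subst O (trans (sym eq) (tgt-m u)) (on-step ov)) ¬ou
          ... | no ¬ou | no ¬ov = trans (sym (tgt-m u)) (trans eq (tgt-m v))

          f-off : ∀ v → ¬ P v → f v ≡ m v
          f-off v ¬pv with O? v
          ... | yes ov = contradiction (O⇒P ov) ¬pv
          ... | no _   = refl

          f≢m : f w ≢ m w
          f≢m with O? w
          ... | yes _  = proj₁ (proj₂ (proj₂ (step w)) pw)
          ... | no ¬ow = contradiction on-start ¬ow

lookup-injective : ∀ {a} {A : Set a} {xs : List A} → Unique xs → ∀ {i j} → List.lookup xs i ≡ List.lookup xs j → i ≡ j
lookup-injective (_  ∷ _) {zero}  {zero}  _  = refl
lookup-injective (x∉ ∷ _) {zero}  {suc j} eq = contradiction eq (All.lookup x∉ (∈-lookup j))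
lookup-injective (x∉ ∷ _) {suc i} {zero}  eq = contradiction (sym eq) (All.lookup x∉ (∈-lookup i))
lookup-injective (_  ∷ u) {suc i} {suc j} eq = cong suc (lookup-injective u eq)

flip : Fin 2 → Fin 2
flip 0F = 1F
flip 1F = 0F

flip-≢ : ∀ b → flip b ≢ b
flip-≢ 0F ()
flip-≢ 1F ()

Differ : ∀ {n ε} (f g : Fin n → Fin ε) → Set
Differ f g = ∃ λ v → f v ≢ g v

differ-or-≗ : ∀ {n ε} (f g : Fin n → Fin ε) → Differ f g ⊎ f ≗ g
differ-or-≗ f g with any? (λ v → ¬? (f v ≟ g v))
... | yes d  = inj₁ d
... | no ¬d = inj₂ λ v → decidable-stable (f v ≟ g v) (λ ne → ¬d (v , ne))

-- Counting the matchings through an edge; strong connectivity.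

record Setting {n ε : ℕ} (tail head : Fin ε → Fin n) : Set₁ where
  open Selections tail head public
  field
    covered   : ∀ e → ∃ λ f → Selection f × e ∈ₛ f
    -- Connectedness without paths: `Q` and `R` are the traces on the two classes of one vertex set
    -- that no edge leaves.
    connected : (Q R : Fin n → Set) → (∀ e → Q (tail e) → R (head e)) →
                (∀ e → R (head e) → Q (tail e)) → ∃ Q → ∀ v → Q v

  -- Uniqueness only, since `covered` supplies existence. Selections are compared pointwise because
  -- they are functions.
  One : Fin ε → Set
  One e = ∀ {f g} → Selection f → Selection g → e ∈ₛ f → e ∈ₛ g → f ≗ g

  record Two (e : Fin ε) : Set where
    field
      sel          : Fin 2 → Fin n → Fin ε
      sel-selects  : ∀ b → Selection (sel b)
      sel-∋        : ∀ b → e ∈ₛ sel b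
      sel-distinct : Differ (sel 0F) (sel 1F)
      sel-only     : ∀ {f} → Selection f → e ∈ₛ f → ∃ λ b → f ≗ sel b

    sel-injective : ∀ {b c} → sel b ≗ sel c → b ≡ c
    sel-injective {0F} {0F} _  = refl
    sel-injective {0F} {1F} eq = contradiction (eq _) (proj₂ sel-distinct)
    sel-injective {1F} {0F} eq = contradiction (sym (eq _)) (proj₂ sel-distinct)
    sel-injective {1F} {1F} _  = refl

  open Two public

  no-three : ∀ {e} → Two e → ∀ {f g h} → Selection f → Selection g → Selection h →
             e ∈ₛ f → e ∈ₛ g → e ∈ₛ h → Differ f g → Differ g h → Differ f h → ⊥
  no-three t F G H e∈f e∈g e∈h (u , f≢g) (v , g≢h) (w , f≢h)
    with sel-only t F e∈f | sel-only t G e∈g | sel-only t H e∈h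
  ... | 0F , p | 0F , q | _      = f≢g (trans (p u) (sym (q u)))
  ... | 1F , p | 1F , q | _      = f≢g (trans (p u) (sym (q u)))
  ... | _      | 0F , p | 0F , q = g≢h (trans (p v) (sym (q v)))
  ... | _      | 1F , p | 1F , q = g≢h (trans (p v) (sym (q v)))
  ... | 0F , p | _      | 0F , q = f≢h (trans (p w) (sym (q w)))
  ... | 1F , p | _      | 1F , q = f≢h (trans (p w) (sym (q w)))

  opaque
    second : ∀ {e f} → Two e → Selection f → e ∈ₛ f → ∃ λ g → Selection g × e ∈ₛ g × Differ g f
    second {e} {f} t F e∈f with b , eq ← sel-only t F e∈f =
      sel t (flip b) , sel-selects t (flip b) , sel-∋ t (flip b) , differs
      where
      differs : Differ (sel t (flip b)) f
      differs with differ-or-≗ (sel t (flip b)) f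
      ... | inj₁ d   = d
      ... | inj₂ eq′ = contradiction (sel-injective t (λ v → trans (eq′ v) (eq v))) (flip-≢ b)

  at : ∀ f {e v} → tail e ≡ v → e ∈ₛ f → f v ≡ e
  at f refl e∈f = e∈f

  through : ∀ {f e v} → Selection f → f v ≡ e → e ∈ₛ f
  through F refl = ∈ₛ-self F _

  module Contracted {m : Fin n → Fin ε} (M : Selection m) where
    open Contract m M public

    -- Each edge lies in a selection `f`, and `tgt ∘ f` is a permutation preserving `P`; its inverse
    -- preserves `P` too, so arcs can be reversed. A vertex of the second class inherits `P` from
    -- its partner in `m`.
    forward-closed : (P : Fin n → Set) → (∀ e → P (tail e) → P (tgt e)) → ∃ P → ∀ v → P v
    forward-closed P closed = connected P (λ w → ∃ λ v → head (m v) ≡ w × P v)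
      (λ e p → tgt e , head-tgt e , closed e p)
      (λ e (v , eq , p) → back e (subst P (trans (sym (tgt-m v)) (head≡⇒tgt≡ eq)) p))
      where
      back : ∀ e → P (tgt e) → P (tail e)
      back e p with f , F , e∈f ← covered e =
        invariant-reverse (tgt ∘ f) (tgt-injective F) P
          (λ {x} px → closed (f x) (subst P (sym (tail-at F x)) px))
          (subst (P ∘ tgt) (sym e∈f) p)

  -- All edges in two matchings: absence of parallel edges and the degree bound.

  module AllTwo (two : ∀ e → Two e) (third : ∀ (u v : Fin n) → ∃ λ (z : Fin n) → z ≢ u × z ≢ v) where

    module Switch {m : Fin n → Fin ε} (M : Selection m) where
      open Contracted M public

      private
        alternative : ∀ x → ∃ λ f → Selection f × m x ∈ₛ f × Differ f m
        alternative x = second (two (m x)) M (∈ₛ-self M x)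

      opaque
        alt : Fin n → Fin n → Fin ε
        alt x = proj₁ (alternative x)

        alt-selects : ∀ x → Selection (alt x)
        alt-selects x = proj₁ (proj₂ (alternative x))

        alt-fixes : ∀ x → alt x x ≡ m x
        alt-fixes x = at (alt x) (tail-at M x) (proj₁ (proj₂ (proj₂ (alternative x))))

        alt-moves : ∀ x → Differ (alt x) m
        alt-moves x = proj₂ (proj₂ (proj₂ (alternative x)))

      no-three-at : ∀ {f g h} v → Selection f → Selection g → Selection h →
                    f v ≡ g v → f v ≡ h v → Differ f g → Differ g h → Differ f h → ⊥
      no-three-at {f} v F G H eq eq′ = no-three (two (f v)) F G H
        (∈ₛ-self F v) (through G (sym eq)) (through H (sym eq′))

      Moved : Fin n → Fin n → Set
      Moved x v = alt x v ≢ m v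

      moved? : ∀ x → Decidable (Moved x)
      moved? x v = ¬? (alt x v ≟ m v)

      fixed : ∀ x {v} → ¬ Moved x v → alt x v ≡ m v
      fixed x {v} = decidable-stable (alt x v ≟ m v)

      moved-≢ : ∀ {x v} → Moved x v → v ≢ x
      moved-≢ {x} mv refl = mv (alt-fixes x)

      -- If the target were fixed, `alt x` would enter it both along the `m`-edge there and along
      -- the arc from `v`, so the target would be `v` itself.
      moved-tgt : ∀ {x v} → Moved x v → Moved x (tgt (alt x v))
      moved-tgt {x} {v} mv eq =
        mv (subst (λ w → alt x w ≡ m w)
             (tgt-injective (alt-selects x) (trans (cong tgt eq) (tgt-m _))) eq)

      -- The edge `m x` already lies in `m` and `alt x`, which leaves no third selection.
      alt-unique : ∀ {f x} → Selection f → f x ≡ m x → Differ f m → alt x ≗ f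
      alt-unique {f} {x} F fx d with differ-or-≗ (alt x) f
      ... | inj₂ eq = eq
      ... | inj₁ d′ = ⊥-elim (no-three-at x (alt-selects x) F M
                        (trans (alt-fixes x) (sym fx)) (alt-fixes x) d′ d (alt-moves x))

      opaque
        -- A cycle avoiding `x` and `c` would give a selection through `m x` other than `m`, that is
        -- `alt x`; but it would fix `c`.
        sink : ∀ {x c} → Moved x c →
               ∃ λ u → u ≢ x × u ≢ c × (∀ {e} → tail e ≡ u → e ≢ m u → tgt e ≡ x ⊎ tgt e ≡ c)
        sink {x} {c} mc with cycle-or-sink {P = λ u → u ≢ x × u ≢ c}
                               (λ u → ¬? (u ≟ x) ×-dec ¬? (u ≟ c)) (third x c)
        ... | inj₁ (f , F , d , off) = contradiction
                (trans (alt-unique F (off x λ (x≢x , _) → x≢x refl) d c) (off c λ (_ , c≢c) → c≢c refl)) mc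
        ... | inj₂ (u , (u≢x , u≢c) , leaves) = u , u≢x , u≢c , into
          where
          into : ∀ {e} → tail e ≡ u → e ≢ m u → tgt e ≡ x ⊎ tgt e ≡ c
          into {e} t ne with tgt e ≟ x | tgt e ≟ c
          ... | yes p | _     = inj₁ p
          ... | no _  | yes q = inj₂ q
          ... | no p  | no q  = contradiction (p , q) (leaves t ne)

      opaque
        -- If `l` is parallel to `m v`, then `m` and its variant `m′` share all edges away from `v`,
        -- so every other selection avoids those edges. A selection `t` through a third edge at `v`
        -- would then have to enter `v` from two vertices.
        no-loops : ∀ {e} → tgt e ≡ tail e → e ≡ m (tail e)
        no-loops {l} loop = decidable-stable (l ≟ m v) impossible
          where
          v : Fin n
          v = tail l

          module _ (l≢mv : l ≢ m v) where
            m′ : Fin n → Fin ε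
            m′ = replace m v l

            M′ : Selection m′
            M′ = replace-parallel M refl (tgt≡⇒head≡ (trans loop (sym (tgt-m v))))

            m′≢m : Differ m′ m
            m′≢m = v , λ eq → l≢mv (trans (sym (replace-at m v l)) eq)

            moves-others : ∀ {f} → Selection f → Differ f m → Differ f m′ → ∀ {g} → g ≢ v → f g ≢ m g
            moves-others F d d′ {g} g≢v eq =
              no-three-at g F M′ M (trans eq (sym (replace-off m v l g≢v))) eq d′ m′≢m d

            F : Selection (alt v)
            F = alt-selects v
            f : Fin n → Fin ε
            f = alt v

            f-moves : ∀ {g} → g ≢ v → f g ≢ m g
            f-moves = moves-others F (alt-moves v)
              (v , λ eq → l≢mv (trans (sym (replace-at m v l)) (trans (sym eq) (alt-fixes v))))

            escape : ∃ λ e → tail e ≡ v × e ≢ m v × e ≢ l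
            escape with any? (λ e → (tail e ≟ v) ×-dec ¬? (e ≟ m v) ×-dec ¬? (e ≟ l))
            ... | yes found = found
            -- With only `m v` and `l` at `v`, no arc would leave the set consisting of `v`.
            ... | no none   = contradiction (forward-closed (_≡ v) closed (v , refl) _) (proj₁ (proj₂ (third v v)))
              where
              closed : ∀ e → tail e ≡ v → tgt e ≡ v
              closed e t with e ≟ m v | e ≟ l
              ... | yes refl | _        = tgt-m v
              ... | no _     | yes refl = loop
              ... | no p     | no q     = contradiction (e , t , p , q) none

            t : Fin n → Fin ε
            t  = proj₁ (covered (proj₁ escape))
            T : Selection t
            T  = proj₁ (proj₂ (covered (proj₁ escape)))

            tv : t v ≡ proj₁ escape
            tv = at t (proj₁ (proj₂ escape)) (proj₂ (proj₂ (covered (proj₁ escape))))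

            tv≢mv : t v ≢ m v
            tv≢mv eq = proj₁ (proj₂ (proj₂ escape)) (trans (sym tv) eq)

            tv≢l : t v ≢ l
            tv≢l eq = proj₂ (proj₂ (proj₂ escape)) (trans (sym tv) eq)

            t-moves : ∀ {g} → g ≢ v → t g ≢ m g
            t-moves = moves-others T (v , tv≢mv) (v , λ eq → tv≢l (trans eq (replace-at m v l)))

            -- A shared edge would lie in `f`, in `f` with `l` put in at `v`, and in `t`.
            t≢f : ∀ {g} → g ≢ v → t g ≢ f g
            t≢f {g} g≢v eq = no-three-at g F
              (replace-parallel F refl (tgt≡⇒head≡ (trans loop (trans (sym (tgt-m v)) (cong tgt (sym (alt-fixes v)))))))
              T (sym (replace-off f v l g≢v)) (sym eq)
              (v , λ eq → l≢mv (trans (sym (replace-at f v l)) (trans (sym eq) (alt-fixes v))))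
              (v , λ eq → tv≢l (trans (sym eq) (replace-at f v l)))
              (v , λ eq → tv≢mv (trans (sym eq) (alt-fixes v)))

            -- Here `alt g` is `m′`, so it moves `v` and there is a sink `u` with arcs into `g` and
            -- `v` only. As `f` fixes `v`, its edge at `u` enters `g`. If `t u` entered `g` as well,
            -- it would be parallel to `f u`, and the exchange would give a third selection through
            -- `m v`.
            into-v : ∀ {g} → g ≢ v → ∃ λ u → u ≢ v × u ≢ g × tgt (t u) ≡ v
            into-v {g} g≢v with sink {g} {v} altg-v
              where
              altg-v : alt g v ≢ m v
              altg-v eq = l≢mv (trans (sym (replace-at m v l))
                (trans (sym (alt-unique {f = m′} M′ (replace-off m v l g≢v) m′≢m v)) eq))
            ... | u , u≢g , u≢v , into = u , u≢v , u≢g , tu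
              where
              fu : tgt (f u) ≡ g
              fu with into (tail-at F u) (f-moves u≢v)
              ... | inj₁ p = p
              ... | inj₂ q = contradiction (tgt-injective F (trans q (trans (sym (tgt-m v)) (cong tgt (sym (alt-fixes v)))))) u≢v
              tu : tgt (t u) ≡ v
              tu with into (tail-at T u) (t-moves u≢v)
              ... | inj₂ q = q
              ... | inj₁ p = ⊥-elim (no-three-at v F
                        (replace-parallel F (tail-at T u) (tgt≡⇒head≡ (trans p (sym fu)))) M
                        (sym (replace-off f u (t u) (u≢v ∘ sym))) (alt-fixes v)
                        (u , λ eq → t≢f u≢v (trans (sym (replace-at f u (t u))) (sym eq)))
                        (u , λ eq → t-moves u≢v (trans (sym (replace-at f u (t u))) eq))
                        (u , f-moves u≢v))

            impossible : ⊥
            impossible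
              -- The second use starts from the vertex found by the first and so yields a different
              -- one.
              with g , g≢v , _ ← third v v
              with u , u≢v , _ , tu ← into-v g≢v
              with w , w≢v , w≢u , tw ← into-v u≢v
              = w≢u (tgt-injective T (trans tw (sym tu)))

    opaque
      -- After contracting a selection through `e`, the edge `e′` is a loop.
      no-parallel : ∀ {e e′} → tail e ≡ tail e′ → head e ≡ head e′ → e ≡ e′
      no-parallel {e} {e′} te he with f , F , e∈f ← covered e =
        trans (sym e∈f) (trans (cong f te) (sym (no-loops
          (trans (sym (head≡⇒tgt≡ (trans (cong head e∈f) he))) (trans (tgt-m _) te)))))
        where open Switch F

    opaque
      -- Each edge is in two matchings, so counting the matchings through the
      -- edges c and through the edges d gives 2a ≤ 2b.
      degree-≤ : ∀ {a b} (c : Fin a → Fin ε) (d : Fin b → Fin ε) →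
                 (∀ {f} → Selection f → ∀ i j → c i ∈ₛ f → c j ∈ₛ f → i ≡ j) →
                 (∀ {f} → Selection f → ∃ λ j → d j ∈ₛ f) → a ≤ b
      degree-≤ {a} {b} c d conflict hit = *-cancelʳ-≤ a b 2 (injective⇒≤ {f = image} image-injective)
        where
        f : Fin a × Fin 2 → Fin n → Fin ε
        f (i , s) = sel (two (c i)) s

        F : ∀ p → Selection (f p)
        F (i , s) = sel-selects (two (c i)) s

        slot : ∀ p → ∃ λ j → ∃ λ s → f p ≗ sel (two (d j)) s
        slot p with j , d∈ ← hit (F p) = j , sel-only (two (d j)) (F p) d∈

        slot-injective : ∀ p q → proj₁ (slot p) ≡ proj₁ (slot q) →
                         proj₁ (proj₂ (slot p)) ≡ proj₁ (proj₂ (slot q)) → p ≡ q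
        slot-injective p@(i , s) q@(j , t) eq₁ eq₂ =
          same (λ v → trans (proj₂ (proj₂ (slot p)) v)
                     (trans (cong₂ (λ k u → sel (two (d k)) u v) eq₁ eq₂)
                            (sym (proj₂ (proj₂ (slot q)) v))))
          where
          same : f p ≗ f q → p ≡ q
          same eq with conflict (F q) i j (trans (sym (eq _)) (sel-∋ (two (c i)) s)) (sel-∋ (two (c j)) t)
          ... | refl = cong (i ,_) (sel-injective (two (c i)) eq)

        image : Fin (a ℕ.* 2) → Fin (b ℕ.* 2)
        image k = combine (proj₁ (slot (remQuot 2 k))) (proj₁ (proj₂ (slot (remQuot 2 k))))

        image-injective : Injective _≡_ _≡_ image
        image-injective {k} {l} eq
          with p , q ← combine-injective _ _ _ _ eq
          = trans (sym (combine-remQuot {a} 2 k))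
              (trans (cong (λ (i , s) → combine i s) (slot-injective (remQuot 2 k) (remQuot 2 l) p q))
                (combine-remQuot {a} 2 l))

-- At least three vertices in each class: the graph is `K 3 3`.

module _ {n ε : ℕ} {tail head : Fin ε → Fin n} (S : Setting tail head) where
  open Setting S

  -- K_{N,N} with every edge multiplied B times.
  record Frame (N B : ℕ) : Set where
    field
      left right  : Fin N → Fin n
      left-inj    : ∀ {i j} → left i ≡ left j → i ≡ j
      left-surj   : ∀ v → ∃ λ i → left i ≡ v
      right-inj   : ∀ {i j} → right i ≡ right j → i ≡ j
      right-surj  : ∀ v → ∃ λ i → right i ≡ v
      arc         : Fin N → Fin N → Fin B → Fin ε
      arc-tail    : ∀ i j b → tail (arc i j b) ≡ left i
      arc-head    : ∀ i j b → head (arc i j b) ≡ right j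
      arc-inj     : ∀ {i j b c} → arc i j b ≡ arc i j c → b ≡ c
      arc-surj    : ∀ e → ∃ λ i → ∃ λ j → ∃ λ b → arc i j b ≡ e

  module AtLeastThree (two : ∀ e → Two e) (third : ∀ (u v : Fin n) → ∃ λ (z : Fin n) → z ≢ u × z ≢ v)
                      (x₀ : Fin n) {m : Fin n → Fin ε} (M : Selection m) where
    open AllTwo two third
    open Switch M

    arc-unique : ∀ {e e′} → tail e ≡ tail e′ → tgt e ≡ tgt e′ → e ≡ e′
    arc-unique te tg = no-parallel te (tgt≡⇒head≡ tg)

    Covers : ∀ {b} → (Fin b → Fin ε) → Set
    Covers d = ∀ f → Selection f → ∃ λ j → d j ∈ₛ f

    degree-tail : ∀ {b} {d : Fin b → Fin ε} → Covers d →
                  ∀ {v xs} → All (λ e → tail e ≡ v) xs → Unique xs → length xs ≤ b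
    degree-tail {d = d} hit {v} {xs} tails u = degree-≤ (List.lookup xs) d conflict (hit _)
      where
      conflict : ∀ {f} → Selection f → ∀ i j → List.lookup xs i ∈ₛ f → List.lookup xs j ∈ₛ f → i ≡ j
      conflict {f} F i j p q = lookup-injective u
        (trans (sym (at f (All.lookup tails (∈-lookup i)) p)) (at f (All.lookup tails (∈-lookup j)) q))

    degree-tgt : ∀ {b} {d : Fin b → Fin ε} → Covers d →
                 ∀ {v xs} → All (λ e → tgt e ≡ v) xs → Unique xs → length xs ≤ b
    degree-tgt {d = d} hit {v} {xs} tgts u = degree-≤ (List.lookup xs) d conflict (hit _)
      where
      conflict : ∀ {f} → Selection f → ∀ i j → List.lookup xs i ∈ₛ f → List.lookup xs j ∈ₛ f → i ≡ j
      conflict {f} F i j p q = lookup-injective u (trans (sym p) (trans (cong f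
        (tgt-injective F (trans (cong tgt p)
          (trans (All.lookup tgts (∈-lookup i))
            (sym (trans (cong tgt q) (All.lookup tgts (∈-lookup j)))))))) q))

    opaque
      -- A sink `u` has at most the edges `m u`, one into `x₀` and one into `c`, and every selection
      -- uses an edge at `u`. This is the origin of the degree 3.
      small-cover : ∃ λ (d : Fin 3 → Fin ε) → Covers d
      small-cover
        with c , mc ← alt-moves x₀
        with u , _ , _ , into ← sink {x₀} {c} mc
        = d , hit
        where
        arcTo : Fin n → Fin ε
        arcTo w with any? (λ e → (tail e ≟ u) ×-dec (tgt e ≟ w))
        ... | yes (e , _) = e
        -- A missing arc is replaced by an edge already in the cover, which does no harm.
        ... | no _        = m u

        arcTo-≡ : ∀ {e w} → tail e ≡ u → tgt e ≡ w → arcTo w ≡ e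
        arcTo-≡ {e} {w} t g with any? (λ e → (tail e ≟ u) ×-dec (tgt e ≟ w))
        ... | yes (e′ , t′ , g′) = arc-unique (trans t′ (sym t)) (trans g′ (sym g))
        ... | no none            = contradiction (e , t , g) none

        d : Fin 3 → Fin ε
        d 0F = m u
        d 1F = arcTo x₀
        d 2F = arcTo c

        hit : Covers d
        hit f F with f u ≟ m u
        ... | yes eq = 0F , through F eq
        ... | no ne with into (tail-at F u) ne
        ... | inj₁ p = 1F , through F (sym (arcTo-≡ (tail-at F u) p))
        ... | inj₂ q = 2F , through F (sym (arcTo-≡ (tail-at F u) q))

    no-four-tail : ∀ {v a b c d} → All (λ e → tail e ≡ v) (a ∷ b ∷ c ∷ d ∷ []) →
                   ¬ Unique (a ∷ b ∷ c ∷ d ∷ [])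
    no-four-tail tails u with degree-tail (proj₂ small-cover) tails u
    ... | s≤s (s≤s (s≤s ()))

    no-four-tgt : ∀ {v a b c d} → All (λ e → tgt e ≡ v) (a ∷ b ∷ c ∷ d ∷ []) →
                  ¬ Unique (a ∷ b ∷ c ∷ d ∷ [])
    no-four-tgt tgts u with degree-tgt (proj₂ small-cover) tgts u
    ... | s≤s (s≤s (s≤s ()))

    -- All degrees would be at most 2, so a vertex moved by `alt x₀` would have only its two edges
    -- in `m` and `alt x₀`. The moved vertices would be closed under arcs, yet `x₀` is not among
    -- them.
    no-pair-covers : ∀ {d : Fin 2 → Fin ε} → ¬ Covers d
    no-pair-covers {d} hit =
      forward-closed (Moved x₀) closed (alt-moves x₀) x₀ (alt-fixes x₀)
      where
      closed : ∀ e → Moved x₀ (tail e) → Moved x₀ (tgt e)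
      closed e mv with e ≟ m (tail e) | e ≟ alt x₀ (tail e)
      ... | yes p | _     = subst (Moved x₀) (sym (trans (cong tgt p) (tgt-m _))) mv
      ... | no _  | yes q = subst (Moved x₀ ∘ tgt) (sym q) (moved-tgt mv)
      ... | no p  | no q  with degree-tail hit {tail e} {e ∷ m (tail e) ∷ alt x₀ (tail e) ∷ []}
              (refl ∷ tail-at M _ ∷ tail-at (alt-selects x₀) _ ∷ [])
              ((p ∷ q ∷ []) ∷ ((mv ∘ sym) ∷ []) ∷ [] ∷ [])
      ... | s≤s (s≤s ())

    -- The edges at `u` meet every selection, so two of them cannot be all.
    third-edge : ∀ u a b → ∃ λ e → tail e ≡ u × e ≢ a × e ≢ b
    third-edge u a b with any? (λ e → (tail e ≟ u) ×-dec ¬? (e ≟ a) ×-dec ¬? (e ≟ b))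
    ... | yes found = found
    ... | no none = contradiction hit (no-pair-covers {d})
      where
      d : Fin 2 → Fin ε
      d 0F = a
      d 1F = b
      hit : Covers d
      hit f F with f u ≟ a | f u ≟ b
      ... | yes p | _     = 0F , through F p
      ... | no _  | yes q = 1F , through F q
      ... | no p  | no q  = contradiction (f u , tail-at F u , p , q) none

    -- The sink has two edges besides `m u`; not being parallel, they use both permitted targets.
    exact-sink : ∀ {x c} → Moved x c → ∃ λ u → u ≢ x ×
                 (∀ {e} → tail e ≡ u → e ≢ m u → tgt e ≡ x ⊎ tgt e ≡ c) ×
                 (∃ λ e → tail e ≡ u × tgt e ≡ x) ×
                 (∃ λ e → tail e ≡ u × e ≢ m u × tgt e ≡ c)
    exact-sink mc
      with u , u≢x , u≢c , into ← sink mc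
      with a , ta , a≢m , _ ← third-edge u (m u) (m u)
      with b , tb , b≢m , b≢a ← third-edge u (m u) a
      with into ta a≢m | into tb b≢m
    ... | inj₁ p | inj₁ q = contradiction (arc-unique (trans tb (sym ta)) (trans q (sym p))) b≢a
    ... | inj₂ p | inj₂ q = contradiction (arc-unique (trans tb (sym ta)) (trans q (sym p))) b≢a
    ... | inj₁ p | inj₂ q = u , u≢x , into , (a , ta , p) , (b , tb , b≢m , q)
    ... | inj₂ p | inj₁ q = u , u≢x , into , (b , tb , q) , (a , ta , a≢m , p)

    -- Distinct moved vertices c give arcs into x from distinct sinks u; with
    -- m x and the bound on degrees there are at most two of them.
    moved-pair : ∀ {x a b c} → Moved x a → Moved x b → Moved x c → a ≢ b → a ≢ c → b ≢ c → ⊥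
    moved-pair {x} ma mb mc a≢b a≢c b≢c
      with u , u≢x , into-u , (e , te , ge) , (_ , te′ , ne′ , ge′) ← exact-sink ma
      with v , v≢x , into-v , (f , tf , gf) , (_ , tf′ , nf′ , gf′) ← exact-sink mb
      with w , w≢x , into-w , (h , th , gh) , _ ← exact-sink mc
      = no-four-tgt (tgt-m x ∷ ge ∷ gf ∷ gh ∷ [])
          ( ((m≢ te u≢x) ∷ (m≢ tf v≢x) ∷ (m≢ th w≢x) ∷ [])
          ∷ ((λ { refl → clash (trans (sym te) tf) te′ ne′ ge′ into-v ma a≢b })
            ∷ (λ { refl → clash (trans (sym te) th) te′ ne′ ge′ into-w ma a≢c }) ∷ [])
          ∷ ((λ { refl → clash (trans (sym tf) th) tf′ nf′ gf′ into-w mb b≢c }) ∷ [])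
          ∷ [] ∷ [])
      where
      m≢ : ∀ {e u} → tail e ≡ u → u ≢ x → m x ≢ e
      m≢ te u≢x refl = u≢x (trans (sym te) (tail-at M x))
      -- Sinks belonging to different moved vertices are different: a common one would have an arc
      -- into `p`, which is neither `x` nor `q`.
      clash : ∀ {u v e p q} → u ≡ v → tail e ≡ u → e ≢ m u → tgt e ≡ p →
              (∀ {e} → tail e ≡ v → e ≢ m v → tgt e ≡ x ⊎ tgt e ≡ q) → Moved x p → p ≢ q → ⊥
      clash refl te ne ge into mp p≢q with into te ne
      ... | inj₁ eq = moved-≢ mp (trans (sym ge) eq)
      ... | inj₂ eq = p≢q (trans (sym ge) eq)

    partner-≢ : ∀ {x c} → Moved x c → tgt (alt x c) ≢ c
    partner-≢ {x} {c} mc eq =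
      mc (trans (no-loops (trans eq (sym (tail-at (alt-selects x) c)))) (cong m (tail-at (alt-selects x) c)))

    moved-only : ∀ {x a b c} → Moved x a → Moved x b → a ≢ b → Moved x c → c ≢ a → c ≡ b
    moved-only {b = b} {c} ma mb a≢b mc c≢a =
      decidable-stable (c ≟ b) λ c≢b → moved-pair ma mb mc a≢b (c≢a ∘ sym) (c≢b ∘ sym)

    alt-tgt : ∀ {x a b} → Moved x a → Moved x b → a ≢ b → tgt (alt x a) ≡ b
    alt-tgt ma mb a≢b = moved-only ma mb a≢b (moved-tgt ma) (partner-≢ ma)

    -- If the moved sets of y and z were disjoint, a matching t through an edge
    -- at y other than those of m and of the union of alt y and alt z would
    -- avoid m and the union everywhere, hence be determined by the degree
    -- bound.
    moved-meet : ∀ y z → ∃ λ v → Moved y v × Moved z v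
    moved-meet y z with any? (λ v → moved? y v ×-dec moved? z v)
    ... | yes found = found
    ... | no none = ⊥-elim contra
      where
      apart : ∀ {v} → Moved y v → ¬ Moved z v
      apart my mz = none (_ , my , mz)

      b : Fin n → Fin ε
      b v with moved? y v
      ... | yes _ = alt y v
      ... | no _  = alt z v

      b-y : ∀ {v} → Moved y v → b v ≡ alt y v
      b-y {v} my with moved? y v
      ... | yes _  = refl
      ... | no ¬my = contradiction my ¬my

      b-z : ∀ {v} → ¬ Moved y v → b v ≡ alt z v
      b-z {v} ¬my with moved? y v
      ... | yes my = contradiction my ¬my
      ... | no _   = refl

      alts-differ : Differ (alt y) (alt z)
      alts-differ with v , my ← alt-moves y = v , λ eq → my (trans eq (fixed z (apart my)))

      -- Otherwise `m v` would lie in the three selections `m`, `alt y` and `alt z`. Hence the union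
      -- `b` differs from `m` everywhere.
      moved-z : ∀ {v} → ¬ Moved y v → Moved z v
      moved-z {v} ¬my eq = no-three-at v M (alt-selects y) (alt-selects z)
        (sym (fixed y ¬my)) (sym eq) (_ , proj₂ (alt-moves y) ∘ sym) alts-differ (_ , proj₂ (alt-moves z) ∘ sym)

      b-moves : ∀ v → b v ≢ m v
      b-moves v with moved? y v
      ... | yes my = my
      ... | no ¬my = moved-z ¬my

      B : Selection b
      B = fromTgt tails tgts
        where
        tails : ∀ v → tail (b v) ≡ v
        tails v with moved? y v
        ... | yes _ = tail-at (alt-selects y) v
        ... | no _  = tail-at (alt-selects z) v
        clash : ∀ {u v} → Moved y u → Moved z v → tgt (alt y u) ≢ tgt (alt z v)
        clash my mz eq = apart (moved-tgt my) (subst (Moved z) (sym eq) (moved-tgt mz))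
        tgts : ∀ {u v} → tgt (b u) ≡ tgt (b v) → u ≡ v
        tgts {u} {v} eq with moved? y u | moved? y v
        ... | yes _  | yes _  = tgt-injective (alt-selects y) eq
        ... | no _   | no _   = tgt-injective (alt-selects z) eq
        ... | yes my | no ¬my = contradiction eq (clash my (moved-z ¬my))
        ... | no ¬my | yes my = contradiction (sym eq) (clash my (moved-z ¬my))

      y-fixed : ¬ Moved y y
      y-fixed my = my (alt-fixes y)

      new = third-edge y (m y) (b y)
      e = proj₁ new

      -- Each `m v` already lies in `m` and in `alt y` or `alt z`; each `b v` lies in `b` and in
      -- `alt y` or `alt z`. All of these differ from `t` at `y`.
      avoids : ∀ {t} → Selection t → t y ≡ e → ∀ v → t v ≢ m v × t v ≢ b v
      avoids {t} T ty v = t≢m , t≢b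
        where
        ty≢m : t y ≢ m y
        ty≢m eq = proj₁ (proj₂ (proj₂ new)) (trans (sym ty) eq)
        ty≢b : t y ≢ b y
        ty≢b eq = proj₂ (proj₂ (proj₂ new)) (trans (sym ty) eq)
        t≢y : Differ t (alt y)
        t≢y = y , λ eq → ty≢m (trans eq (alt-fixes y))
        t≢z : Differ t (alt z)
        t≢z = y , λ eq → ty≢b (trans eq (sym (b-z y-fixed)))
        z≢b : Differ (alt z) b
        z≢b = let u , my = alt-moves y in
          u , λ eq → my (sym (trans (sym (fixed z (apart my))) (trans eq (b-y my))))
        t≢m : t v ≢ m v
        t≢m eq with moved? y v
        ... | no ¬my = no-three-at v T (alt-selects y) M (trans eq (sym (fixed y ¬my))) eq t≢y (alt-moves y) (y , ty≢m)
        ... | yes my = no-three-at v T (alt-selects z) M (trans eq (sym (fixed z (apart my)))) eq t≢z (alt-moves z) (y , ty≢m)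
        t≢b : t v ≢ b v
        t≢b eq with moved? y v
        ... | yes my = no-three-at v T (alt-selects y) B eq (trans eq (sym (b-y my)))
                         t≢y (y , λ eq → b-moves y (trans (sym eq) (alt-fixes y))) (y , ty≢b)
        ... | no ¬my = no-three-at v T (alt-selects z) B eq (trans eq (sym (b-z ¬my)))
                         t≢z z≢b (y , ty≢b)

      contra : ⊥
      -- Where the two selections through `e` differ, they provide two edges besides those of `m`
      -- and `b`, four in all.
      contra with sel (two e) | sel-selects (two e) | sel-∋ (two e) | sel-distinct (two e)
      ... | s | sels | ∋ | v , s≢ = no-four-tail {v}
              (tail-at M v ∷ tail-at B v ∷ tail-at (sels 0F) v ∷ tail-at (sels 1F) v ∷ [])
              ( ((b-moves v ∘ sym) ∷ (proj₁ (av 0F) ∘ sym) ∷ (proj₁ (av 1F) ∘ sym) ∷ [])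
              ∷ ((proj₂ (av 0F) ∘ sym) ∷ (proj₂ (av 1F) ∘ sym) ∷ [])
              ∷ (s≢ ∷ []) ∷ [] ∷ [])
        where
        av : ∀ i → s i v ≢ m v × s i v ≢ b v
        av i = avoids (sels i) (at (s i) (proj₁ (proj₂ new)) (∋ i)) v

    module Triangle (p : Fin 3 → Fin n) (p-injective : ∀ {i j} → p i ≡ p j → i ≡ j)
                    (arc : Fin 3 → Fin 3 → Fin ε) (arc-tail : ∀ i j → tail (arc i j) ≡ p i)
                    (arc-tgt : ∀ i j → tgt (arc i j) ≡ p j) where

      arcs-differ : ∀ i {j k} → j ≢ k → arc i j ≢ arc i k
      arcs-differ i j≢k eq =
        j≢k (p-injective (trans (sym (arc-tgt i _)) (trans (cong tgt eq) (arc-tgt i _))))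

      -- The three arcs at `p i` (the one with `j = i` being a loop) exhaust its degree, so no arc
      -- leaves the triangle.
      p-surjective : ∀ v → ∃ λ i → p i ≡ v
      p-surjective = forward-closed (λ v → ∃ λ i → p i ≡ v) closed (p 0F , 0F , refl)
        where
        closed : ∀ e → (∃ λ i → p i ≡ tail e) → ∃ λ j → p j ≡ tgt e
        closed e (i , pi≡) = decidable-stable (any? λ j → p j ≟ tgt e) λ none →
          let differs : ∀ j → arc i j ≢ e
              differs j eq = none (j , trans (sym (arc-tgt i j)) (cong tgt eq))
          in no-four-tail (arc-tail i 0F ∷ arc-tail i 1F ∷ arc-tail i 2F ∷ sym pi≡ ∷ [])
               ( (arcs-differ i (λ ()) ∷ arcs-differ i (λ ()) ∷ differs 0F ∷ [])
               ∷ (arcs-differ i (λ ()) ∷ differs 1F ∷ [])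
               ∷ (differs 2F ∷ []) ∷ [] ∷ [])

      frame : Frame 3 1
      frame = record
        { left = p ; right = head ∘ m ∘ p
        ; left-inj = p-injective ; left-surj = p-surjective
        ; right-inj = p-injective ∘ head-injective M
        ; right-surj = right-surj
        ; arc = λ i j _ → arc i j
        ; arc-tail = λ i j _ → arc-tail i j
        ; arc-head = λ i j _ → trans (sym (head-tgt (arc i j))) (cong (head ∘ m) (arc-tgt i j))
        ; arc-inj = λ { {b = 0F} {c = 0F} _ → refl }
        ; arc-surj = arc-surj
        }
        where
        right-surj : ∀ w → ∃ λ j → head (m (p j)) ≡ w
        right-surj w
          with v , eq ← injective⇒surjective (head ∘ m) (head-injective M) w
          with j , refl ← p-surjective v = j , eq

        arc-surj : ∀ e → ∃ λ i → ∃ λ j → ∃ λ (b : Fin 1) → arc i j ≡ e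
        arc-surj e with i , pi≡ ← p-surjective (tail e) | j , pj≡ ← p-surjective (tgt e) =
          i , j , 0F , arc-unique (trans (arc-tail i j) pi≡) (trans (arc-tgt i j) pj≡)

    -- The 2-cycles are `alt x₀` on `a`, `b`, then `alt a` on `b`, `c`, and `alt b` on `a`, `c`.
    -- They provide the six arcs between distinct vertices, and `m` the three loops.
    frame₃ : Frame 3 1
    frame₃ with alt-moves x₀
    ... | a , ma = Triangle.frame p p-injective arc arc-tail arc-tgt
      where
      b : Fin n
      b = tgt (alt x₀ a)

      mb : Moved x₀ b
      mb = moved-tgt ma

      b≢a : b ≢ a
      b≢a = partner-≢ ma

      -- The 2-cycle of `alt a` meets that of `alt x₀`, but cannot do so at `a`, which `alt a`
      -- fixes.
      mab : Moved a b
      mab with v , mv , mav ← moved-meet x₀ a =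
        subst (Moved a) (moved-only ma mb (b≢a ∘ sym) mv (moved-≢ mav)) mav

      mba : Moved b a
      mba with v , mv , mbv ← moved-meet x₀ b =
        subst (Moved b) (moved-only mb ma b≢a mv (moved-≢ mbv)) mbv

      c : Fin n
      c = tgt (alt a b)

      mac : Moved a c
      mac = moved-tgt mab

      c≢b : c ≢ b
      c≢b = partner-≢ mab

      c≢a : c ≢ a
      c≢a = moved-≢ mac

      mbc : Moved b c
      mbc with v , mav , mbv ← moved-meet a b =
        subst (Moved b) (moved-only mab mac (c≢b ∘ sym) mav (moved-≢ mbv)) mbv

      p : Fin 3 → Fin n
      p 0F = a
      p 1F = b
      p 2F = c

      p-injective : ∀ {i j} → p i ≡ p j → i ≡ j
      p-injective {0F} {0F} _  = refl
      p-injective {0F} {1F} eq = contradiction (sym eq) b≢a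
      p-injective {0F} {2F} eq = contradiction (sym eq) c≢a
      p-injective {1F} {0F} eq = contradiction eq b≢a
      p-injective {1F} {1F} _  = refl
      p-injective {1F} {2F} eq = contradiction (sym eq) c≢b
      p-injective {2F} {0F} eq = contradiction eq c≢a
      p-injective {2F} {1F} eq = contradiction eq c≢b
      p-injective {2F} {2F} _  = refl

      arc : Fin 3 → Fin 3 → Fin ε
      arc 0F 1F = alt x₀ a
      arc 1F 0F = alt x₀ b
      arc 1F 2F = alt a b
      arc 2F 1F = alt a c
      arc 0F 2F = alt b a
      arc 2F 0F = alt b c
      arc 0F 0F = m a
      arc 1F 1F = m b
      arc 2F 2F = m c

      arc-tail : ∀ i j → tail (arc i j) ≡ p i
      arc-tail 0F 1F = tail-at (alt-selects x₀) a
      arc-tail 1F 0F = tail-at (alt-selects x₀) b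
      arc-tail 1F 2F = tail-at (alt-selects a) b
      arc-tail 2F 1F = tail-at (alt-selects a) c
      arc-tail 0F 2F = tail-at (alt-selects b) a
      arc-tail 2F 0F = tail-at (alt-selects b) c
      arc-tail 0F 0F = tail-at M a
      arc-tail 1F 1F = tail-at M b
      arc-tail 2F 2F = tail-at M c

      arc-tgt : ∀ i j → tgt (arc i j) ≡ p j
      arc-tgt 0F 1F = refl
      arc-tgt 1F 0F = alt-tgt mb ma b≢a
      arc-tgt 1F 2F = refl
      arc-tgt 2F 1F = alt-tgt mac mab c≢b
      arc-tgt 0F 2F = alt-tgt mba mbc (c≢a ∘ sym)
      arc-tgt 2F 0F = alt-tgt mbc mba c≢a
      arc-tgt 0F 0F = tgt-m a
      arc-tgt 1F 1F = tgt-m b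
      arc-tgt 2F 2F = tgt-m c

-- Two vertices in each class: the graph is `C₄⁴`.

≢⇒flip : ∀ {x y : Fin 2} → x ≢ y → x ≡ flip y
≢⇒flip {0F} {0F} ne = contradiction refl ne
≢⇒flip {0F} {1F} ne = refl
≢⇒flip {1F} {0F} ne = refl
≢⇒flip {1F} {1F} ne = contradiction refl ne

flip-flip : ∀ x → flip (flip x) ≡ x
flip-flip 0F = refl
flip-flip 1F = refl

module _ {ε : ℕ} {tail head : Fin ε → Fin 2} (S : Setting tail head) where
  open Setting S

  module Exactly2 (two : ∀ e → Two e) {m : Fin 2 → Fin ε} (M : Selection m) where
    open Contracted M

    Arc : Fin 2 → Fin 2 → Fin ε → Set
    Arc i j e = tail e ≡ i × tgt e ≡ j

    opposite : ∀ {i j e f} → Arc i j e → Selection f → e ∈ₛ f → Arc (flip i) (flip j) (f (flip i))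
    opposite {i} {j} {e} {f} (t , g) F e∈f = tail-at F (flip i) , ≢⇒flip λ eq →
      flip-≢ i (tgt-injective F (trans eq (sym (trans (cong tgt (at f t e∈f)) g))))

    cross : ∃ (Arc 0F 1F)
    cross with any? (λ e → (tail e ≟ 0F) ×-dec (tgt e ≟ 1F))
    ... | yes found = found
    ... | no none   = contradiction (forward-closed (_≡ 0F)
            (λ e t → ≢⇒flip (λ g → none (e , t , g))) (0F , refl) 1F) λ ()

    opaque
      some : ∀ i j → ∃ (Arc i j)
      some 0F 0F = m 0F , tail-at M 0F , tgt-m 0F
      some 1F 1F = m 1F , tail-at M 1F , tgt-m 1F
      some 0F 1F = cross
      some 1F 0F with e , a ← cross with f , F , e∈f ← covered e = _ , opposite a F e∈f

    pair : ∀ i j → Two (proj₁ (some (flip i) (flip j)))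
    pair i j = two (proj₁ (some (flip i) (flip j)))

    -- The edges from `i` to `j` are the companions of one fixed edge from `flip i` to `flip j` in
    -- the two matchings through it; hence there are two.
    arc : Fin 2 → Fin 2 → Fin 2 → Fin ε
    arc i j b = sel (pair i j) b i

    is-arc : ∀ i j b → Arc i j (arc i j b)
    is-arc i j b = subst₂ (λ x y → Arc x y (sel (pair i j) b x)) (flip-flip i) (flip-flip j)
      (opposite (proj₂ (some (flip i) (flip j))) (sel-selects (pair i j) b) (sel-∋ (pair i j) b))

    arc-injective : ∀ {i j b c} → arc i j b ≡ arc i j c → b ≡ c
    arc-injective {i} {j} {b} {c} eq = sel-injective (pair i j) same
      where
      same : sel (pair i j) b ≗ sel (pair i j) c
      same v with v ≟ i
      ... | yes refl = eq
      ... | no v≢i with refl ← ≢⇒flip v≢i =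
        trans (at (sel (pair i j) b) (proj₁ (proj₂ (some _ _))) (sel-∋ (pair i j) b))
          (sym (at (sel (pair i j) c) (proj₁ (proj₂ (some _ _))) (sel-∋ (pair i j) c)))

    -- Together with the fixed complementary edge `e′`, the edge `e` forms a selection, which is one
    -- of the two through `e′`.
    arc-surjective : ∀ e → ∃ λ b → arc (tail e) (tgt e) b ≡ e
    arc-surjective e = proj₁ found , trans (sym (proj₂ found i)) f-here
      where
      i = tail e
      j = tgt e

      e′ = proj₁ (some (flip i) (flip j))

      f : Fin 2 → Fin ε
      f v with v ≟ i
      ... | yes _ = e
      ... | no _  = e′

      f-here : f i ≡ e
      f-here with i ≟ i
      ... | yes _ = refl
      ... | no ne = contradiction refl ne

      f-other : f (flip i) ≡ e′
      f-other with flip i ≟ i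
      ... | yes eq = contradiction eq (flip-≢ i)
      ... | no _   = refl

      F : Selection f
      F = fromTgt tails tgts
        where
        tails : ∀ v → tail (f v) ≡ v
        tails v with v ≟ i
        ... | yes eq = sym eq
        ... | no ne  = trans (proj₁ (proj₂ (some (flip i) (flip j)))) (sym (≢⇒flip ne))
        tgts : ∀ {u v} → tgt (f u) ≡ tgt (f v) → u ≡ v
        tgts {u} {v} eq with u ≟ i | v ≟ i
        ... | yes p | yes q = trans p (sym q)
        ... | no p  | no q  = trans (≢⇒flip p) (sym (≢⇒flip q))
        ... | yes p | no q  = contradiction (trans (sym (proj₂ (proj₂ (some _ _)))) (sym eq)) (flip-≢ j)
        ... | no p  | yes q = contradiction (trans (sym (proj₂ (proj₂ (some _ _)))) eq) (flip-≢ j)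

      found : ∃ λ b → f ≗ sel (pair i j) b
      found = sel-only (pair i j) F (through {v = flip i} F f-other)

    frame₂ : Frame S 2 2
    frame₂ = record
      { left = λ i → i ; right = head ∘ m
      ; left-inj = λ eq → eq ; left-surj = λ v → v , refl
      ; right-inj = head-injective M
      ; right-surj = injective⇒surjective (head ∘ m) (head-injective M)
      ; arc = arc
      ; arc-tail = λ i j b → proj₁ (is-arc i j b)
      ; arc-head = λ i j b → trans (sym (head-tgt _)) (cong (head ∘ m) (proj₂ (is-arc i j b)))
      ; arc-inj = arc-injective
      ; arc-surj = λ e → tail e , tgt e , arc-surjective e
      }

-- A matching of 1-matching edges: even cycles and `C₄²`.

module _ {n ε : ℕ} {tail head : Fin ε → Fin n} (S : Setting tail head) where
  open Setting S

  -- The edges split into two disjoint perfect matchings, and `step` advances by two edges. That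
  -- `step` has a single orbit is left to connectedness.
  record Rotation : Set where
    field
      inner outer  : Fin n → Fin ε
      inner-tail   : ∀ v → tail (inner v) ≡ v
      outer-tail   : ∀ v → tail (outer v) ≡ v
      head-inner   : ∀ {u v} → head (inner u) ≡ head (inner v) → u ≡ v
      step         : Fin n → Fin n
      step-inj     : ∀ {u v} → step u ≡ step v → u ≡ v
      step-≢       : ∀ v → step v ≢ v
      outer-head   : ∀ v → head (outer v) ≡ head (inner (step v))
      inner≢outer  : ∀ v → inner v ≢ outer v
      edges        : ∀ e → e ≡ inner (tail e) ⊎ e ≡ outer (tail e)

  -- `c` and `d` are the simple edges of the 4-cycle; `a`, `a′` and `b`, `b′` are the doubled ones.
  record DoubledPair : Set where
    field
      v w       : Fin n
      v≢w       : v ≢ w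
      vertices  : ∀ u → u ≡ v ⊎ u ≡ w
      c d a a′ b b′ : Fin ε
      c-tail    : tail c ≡ v
      d-tail    : tail d ≡ w
      a-tail    : tail a ≡ v
      a′-tail   : tail a′ ≡ v
      b-tail    : tail b ≡ w
      b′-tail   : tail b′ ≡ w
      c≢d-head  : head c ≢ head d
      a-head    : head a ≡ head d
      a′-head   : head a′ ≡ head d
      b-head    : head b ≡ head c
      b′-head   : head b′ ≡ head c
      a≢a′      : a ≢ a′
      b≢b′      : b ≢ b′
      edges     : ∀ e → e ∈ˡ (c ∷ d ∷ a ∷ a′ ∷ b ∷ b′ ∷ [])

  module SingleThrough {m : Fin n → Fin ε} (M : Selection m)
                       (single : ∀ {f v} → Selection f → f v ≡ m v → f ≗ m)
                       (another : ∀ (v : Fin n) → ∃ λ (u : Fin n) → u ≢ v) where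
    open Contracted M

    opaque
      -- A cycle avoiding `v` would give a second selection through `m v`.
      sink : ∀ v → ∃ λ u → u ≢ v × (∀ {e} → tail e ≡ u → e ≢ m u → tgt e ≡ v)
      sink v with cycle-or-sink {P = _≢ v} (λ u → ¬? (u ≟ v)) (another v)
      ... | inj₁ (f , F , (u , f≢m) , off) = contradiction (single F (off v λ v≢v → v≢v refl) u) f≢m
      ... | inj₂ (u , u≢v , leaves) = u , u≢v , λ t ne → decidable-stable (tgt _ ≟ v) (leaves t ne)

      leaves : ∀ u → ∃ λ e → tail e ≡ u × e ≢ m u
      leaves u with any? (λ e → (tail e ≟ u) ×-dec ¬? (e ≟ m u))
      ... | yes found = found
      ... | no none   = contradiction (forward-closed (_≡ u) closed (u , refl) _) (proj₂ (another u))
        where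
        closed : ∀ e → tail e ≡ u → tgt e ≡ u
        closed e t = trans (cong tgt (decidable-stable (e ≟ m u) λ ne → none (e , t , ne))) (tgt-m u)

    -- A sink has at least one arc, and the target of that arc recovers `v`.
    sink-injective : ∀ {v w} → proj₁ (sink v) ≡ proj₁ (sink w) → v ≡ w
    sink-injective {v} {w} eq with e , t , ne ← leaves (proj₁ (sink v)) =
      trans (sym (proj₂ (proj₂ (sink v)) t ne))
        (proj₂ (proj₂ (sink w)) (trans t eq) (λ e≡ → ne (trans e≡ (cong m (sym eq)))))

    out : Fin n → Fin ε
    out v = proj₁ (leaves v)

    out-tail : ∀ v → tail (out v) ≡ v
    out-tail v = proj₁ (proj₂ (leaves v))

    out≢m : ∀ v → out v ≢ m v
    out≢m v = proj₂ (proj₂ (leaves v))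

    opaque
      after-of : ∀ v → ∃ λ w → proj₁ (sink w) ≡ v
      after-of = injective⇒surjective (proj₁ ∘ sink) sink-injective

    -- The inverse of the map from a vertex to its sink, hence the only possible target of an arc
    -- leaving `v`.
    after : Fin n → Fin n
    after v = proj₁ (after-of v)

    after-injective : ∀ {u v} → after u ≡ after v → u ≡ v
    after-injective {u} {v} eq =
      trans (sym (proj₂ (after-of u))) (trans (cong (proj₁ ∘ sink) eq) (proj₂ (after-of v)))

    after-≢ : ∀ v → after v ≢ v
    after-≢ v eq = proj₁ (proj₂ (sink (after v))) (trans (proj₂ (after-of v)) (sym eq))

    leaves-to-next : ∀ {e v} → tail e ≡ v → e ≢ m v → tgt e ≡ after v
    leaves-to-next {e} {v} t ne = proj₂ (proj₂ (sink (after v))) (trans t (sym (proj₂ (after-of v))))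
      (λ eq → ne (trans eq (cong m (proj₂ (after-of v)))))

    all-out : ∀ {f} → (∀ v → tail (f v) ≡ v) → (∀ v → f v ≢ m v) → Selection f
    all-out {f} t ne = fromTgt t λ {u} {v} eq → after-injective
      (trans (sym (leaves-to-next (t u) (ne u))) (trans eq (leaves-to-next (t v) (ne v))))

    Out : Selection out
    Out = all-out out-tail out≢m

    divert : ∀ {v e} → tail e ≡ v → e ≢ m v → Selection (replace out v e)
    divert {v} {e} t ne = replace-parallel Out t
      (tgt≡⇒head≡ (trans (leaves-to-next t ne) (sym (leaves-to-next (out-tail v) (out≢m v)))))

    rotation : (∀ e → e ≢ m (tail e) → e ≡ out (tail e)) → Rotation
    rotation only = record
      { inner = m ; outer = out ; inner-tail = tail-at M ; outer-tail = out-tail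
      ; head-inner = head-injective M
      ; step = after ; step-inj = after-injective ; step-≢ = after-≢
      ; outer-head = λ v → trans (sym (head-tgt (out v))) (cong (head ∘ m) (leaves-to-next (out-tail v) (out≢m v)))
      ; inner≢outer = λ v → out≢m v ∘ sym
      ; edges = split
      }
      where
      split : ∀ e → e ≡ m (tail e) ⊎ e ≡ out (tail e)
      split e with e ≟ m (tail e)
      ... | yes p = inj₁ p
      ... | no ne = inj₂ (only e ne)

    module Doubled (classify : ∀ e → One e ⊎ Two e)
                   (unmixed : ∀ {f u v} → Selection f → One (f u) → Two (f v) → ⊥)
                   {v e} (te : tail e ≡ v) (e≢m : e ≢ m v) (e≢out : e ≢ out v) where

      -- If one edge of `out` were a 1-matching edge, so would be the edge at `after v`; yet `out`
      -- and its diversion to `e` at `v` share that edge.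
      two-out : ∀ u → Two (out u)
      two-out u with classify (out u)
      ... | inj₂ t = t
      ... | inj₁ o with classify (out (after v))
      ... | inj₂ t = ⊥-elim (unmixed Out o t)
      ... | inj₁ o′ = contradiction
              (trans (sym (o′ Out (divert te e≢m) (∈ₛ-self Out _)
                 (through (divert te e≢m) (replace-off out v e (after-≢ v))) v))
                refl)
              (λ eq → e≢out (trans (sym (replace-at out v e)) eq))

      second-out = second (two-out v) Out (∈ₛ-self Out v)

      t : Fin n → Fin ε
      t = proj₁ second-out

      T : Selection t
      T = proj₁ (proj₂ second-out)

      t-v : t v ≡ out v
      t-v = at t (out-tail v) (proj₁ (proj₂ (proj₂ second-out)))

      -- The second selection through `out v` leaves `out` at another vertex, which is therefore
      -- also doubled.
      w : Fin n
      w = proj₁ (proj₂ (proj₂ (proj₂ second-out)))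

      t≢out : t w ≢ out w
      t≢out = proj₂ (proj₂ (proj₂ (proj₂ second-out)))

      t≢m : t w ≢ m w
      t≢m eq = out≢m v (trans (sym t-v) (single T eq v))

      v≢w : v ≢ w
      v≢w eq = t≢out (subst (λ z → t z ≡ out z) eq t-v)

      -- Otherwise `out z` would lie in `out` and in its diversions to `x` and to `y`.
      diverts : ∀ {u z x y} → u ≢ z → tail x ≡ u → tail y ≡ u → x ≢ m u → y ≢ m u →
                x ≢ out u → y ≢ out u → x ≡ y
      diverts {u} {z} {x} {y} u≢z tx ty x≢m y≢m x≢o y≢o = decidable-stable (x ≟ y) λ x≢y →
        no-three (two-out z) Out (divert tx x≢m) (divert ty y≢m) (∈ₛ-self Out z)
          (through (divert tx x≢m) (replace-off out u x (u≢z ∘ sym)))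
          (through (divert ty y≢m) (replace-off out u y (u≢z ∘ sym)))
          (u , λ eq → x≢o (trans (sym (replace-at out u x)) (sym eq)))
          (u , λ eq → x≢y (trans (sym (replace-at out u x)) (trans eq (replace-at out u y))))
          (u , λ eq → y≢o (trans (sym (replace-at out u y)) (sym eq)))

      -- At any further vertex `out z` would lie in `out`, in its diversion at `v` and in its
      -- diversion at `w`.
      only-two : ∀ z → z ≡ v ⊎ z ≡ w
      only-two z with z ≟ v | z ≟ w
      ... | yes p | _ = inj₁ p
      ... | no _ | yes q = inj₂ q
      ... | no z≢v | no z≢w = ⊥-elim (no-three (two-out z) Out (divert te e≢m) (divert (tail-at T w) t≢m)
              (∈ₛ-self Out z)
              (through (divert te e≢m) (replace-off out v e z≢v))
              (through (divert (tail-at T w) t≢m) (replace-off out w (t w) z≢w))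
              (v , λ eq → e≢out (trans (sym (replace-at out v e)) (sym eq)))
              (v , λ eq → e≢out (trans (sym (replace-at out v e)) (trans eq (replace-off out w (t w) v≢w))))
              (w , λ eq → t≢out (trans (sym (replace-at out w (t w))) (sym eq))))

      after-v : after v ≡ w
      after-v with only-two (after v)
      ... | inj₁ p = contradiction p (after-≢ v)
      ... | inj₂ q = q

      after-w : after w ≡ v
      after-w with only-two (after w)
      ... | inj₁ p = p
      ... | inj₂ q = contradiction q (after-≢ w)

      leaves-head : ∀ {x u z} → after u ≡ z → tail x ≡ u → x ≢ m u → head x ≡ head (m z)
      leaves-head refl tx ne = trans (sym (head-tgt _)) (cong (head ∘ m) (leaves-to-next tx ne))

      find : ∀ x → x ∈ˡ (m v ∷ m w ∷ out v ∷ e ∷ out w ∷ t w ∷ [])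
      find x with only-two (tail x)
      find x | inj₁ p with x ≟ m v | x ≟ out v
      ... | yes q | _     = here q
      ... | no _  | yes q = there (there (here q))
      ... | no q  | no r  = there (there (there (here (diverts v≢w p te q e≢m r e≢out))))
      find x | inj₂ p with x ≟ m w | x ≟ out w
      ... | yes q | _     = there (here q)
      ... | no _  | yes q = there (there (there (there (here q))))
      ... | no q  | no r  = there (there (there (there (there (here
                              (diverts (v≢w ∘ sym) p (tail-at T w) q t≢m r t≢out))))))

      doubledPair : DoubledPair
      doubledPair = record
        { v = v ; w = w ; v≢w = v≢w ; vertices = only-two
        ; c = m v ; d = m w ; a = out v ; a′ = e ; b = out w ; b′ = t w
        ; c-tail = tail-at M v ; d-tail = tail-at M w ; a-tail = out-tail v ; a′-tail = te
        ; b-tail = out-tail w ; b′-tail = tail-at T w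
        ; c≢d-head = v≢w ∘ head-injective M
        ; a-head = leaves-head after-v (out-tail v) (out≢m v) ; a′-head = leaves-head after-v te e≢m
        ; b-head = leaves-head after-w (out-tail w) (out≢m w) ; b′-head = leaves-head after-w (tail-at T w) t≢m
        ; a≢a′ = e≢out ∘ sym ; b≢b′ = t≢out ∘ sym
        ; edges = find
        }

-- Identification with the concrete graphs.

least : ∀ {p} {P : ℕ → Set p} → Decidable P → ∀ k → P k → ∃ λ j → P j × (∀ {i} → i < j → ¬ P i)
least {P = P} P? k = go (<-wellFounded k)
  where
  go : ∀ {k} → Acc _<_ k → P k → ∃ λ j → P j × (∀ {i} → i < j → ¬ P i)
  go {k} (acc rs) pk with anyUpTo? P? k
  ... | yes (j , j<k , pj) = go (rs j<k) pj
  ... | no none            = k , pk , λ i<k pi → none (_ , i<k , pi)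

toℕ-next : ∀ {k} .{{_ : NonZero k}} (i : Fin k) →
           (suc (toℕ i) < k × toℕ (next i) ≡ suc (toℕ i)) ⊎ (suc (toℕ i) ≡ k × toℕ (next i) ≡ 0)
toℕ-next {k} i with m≤n⇒m<n∨m≡n (toℕ<n i)
... | inj₁ lt = inj₁ (lt , trans (toℕ-fromℕ< (m%n<n (suc (toℕ i)) k)) (m<n⇒m%n≡m lt))
... | inj₂ eq = inj₂ (eq , trans (toℕ-fromℕ< (m%n<n (suc (toℕ i)) k)) (trans (cong (_% k) eq) (n%n≡0 k)))

Spans : {A B : Set} → A ⊎ B → A ⊎ B → A → B → Set
Spans x y a b = (x ≡ inj₁ a × y ≡ inj₂ b) ⊎ (x ≡ inj₂ b × y ≡ inj₁ a)

-- The maps start from `H`, whose vertices and edges are concrete enough for case analysis; they are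
-- inverted once, in `realises⇒≅`.
record Realises {n ε : ℕ} (tail head : Fin ε → Fin n) (H : Multigraph) : Set where
  field
    vertex      : Vertex H → Fin n ⊎ Fin n
    vertex-inj  : ∀ {u v} → vertex u ≡ vertex v → u ≡ v
    vertex-surj : ∀ x → ∃ λ v → vertex v ≡ x
    edge        : Edge H → Fin ε
    edge-inj    : ∀ {e f} → edge e ≡ edge f → e ≡ f
    edge-surj   : ∀ e → ∃ λ f → edge f ≡ e
    ends-match  : ∀ e →
      Spans (vertex (proj₁ (ends H e))) (vertex (proj₂ (ends H e))) (tail (edge e)) (head (edge e))

realises-K₂* : ∀ {ε} (tail head : Fin ε → Fin 1) → Realises tail head (K₂* ε)
realises-K₂* {ε} tail head = record
  { vertex = vertex ; vertex-inj = inj ; vertex-surj = surj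
  ; edge = λ e → e ; edge-inj = λ eq → eq ; edge-surj = λ e → e , refl
  ; ends-match = λ e → inj₁ (cong inj₁ (only (tail e)) , cong inj₂ (only (head e)))
  }
  where
  only : ∀ (i : Fin 1) → 0F ≡ i
  only 0F = refl
  vertex : Fin 2 → Fin 1 ⊎ Fin 1
  vertex 0F = inj₁ 0F
  vertex 1F = inj₂ 0F
  inj : ∀ {u v} → vertex u ≡ vertex v → u ≡ v
  inj {0F} {0F} _ = refl
  inj {0F} {1F} ()
  inj {1F} {1F} _ = refl
  surj : ∀ x → ∃ λ v → vertex v ≡ x
  surj (inj₁ 0F) = 0F , refl
  surj (inj₂ 0F) = 1F , refl

module _ {n ε : ℕ} {tail head : Fin ε → Fin n} (S : Setting tail head) where

  realises-K₃₃ : Frame S 3 1 → Realises tail head (K 3 3)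
  realises-K₃₃ F = record
    { vertex = vertex ; vertex-inj = inj ; vertex-surj = surj
    ; edge = edge
    ; edge-inj = edge-inj
    ; edge-surj = edge-surj
    ; ends-match = λ e → inj₁
        ( trans (cong place (splitAt-↑ˡ 3 (proj₁ (remQuot {3} 3 e)) 3)) (cong inj₁ (sym (arc-tail _ _ 0F)))
        , trans (cong place (splitAt-↑ʳ 3 3 (proj₂ (remQuot {3} 3 e)))) (cong inj₂ (sym (arc-head _ _ 0F))))
    }
    where
    open Frame F
    place : Fin 3 ⊎ Fin 3 → Fin n ⊎ Fin n
    place (inj₁ i) = inj₁ (left i)
    place (inj₂ j) = inj₂ (right j)

    vertex : Fin 6 → Fin n ⊎ Fin n
    vertex v = place (splitAt 3 v)

    place-inj : ∀ {x y} → place x ≡ place y → x ≡ y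
    place-inj {inj₁ _} {inj₁ _} eq = cong inj₁ (left-inj (inj₁-injective eq))
    place-inj {inj₂ _} {inj₂ _} eq = cong inj₂ (right-inj (inj₂-injective eq))

    inj : ∀ {u v} → vertex u ≡ vertex v → u ≡ v
    inj {u} {v} eq = trans (sym (join-splitAt 3 3 u)) (trans (cong (join 3 3) (place-inj eq)) (join-splitAt 3 3 v))

    surj : ∀ x → ∃ λ v → vertex v ≡ x
    surj (inj₁ x) with i , refl ← left-surj x  = i ↑ˡ 3 , cong place (splitAt-↑ˡ 3 i 3)
    surj (inj₂ x) with j , refl ← right-surj x = 3 ↑ʳ j , cong place (splitAt-↑ʳ 3 3 j)

    edge′ : Fin 3 × Fin 3 → Fin ε
    edge′ (i , j) = arc i j 0F

    edge : Fin 9 → Fin ε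
    edge e = edge′ (remQuot {3} 3 e)

    edge′-inj : ∀ {p q} → edge′ p ≡ edge′ q → p ≡ q
    edge′-inj eq = cong₂ _,_
      (left-inj (trans (sym (arc-tail _ _ 0F)) (trans (cong tail eq) (arc-tail _ _ 0F))))
      (right-inj (trans (sym (arc-head _ _ 0F)) (trans (cong head eq) (arc-head _ _ 0F))))

    edge-inj : ∀ {e f} → edge e ≡ edge f → e ≡ f
    edge-inj {e} {f} eq = trans (sym (combine-remQuot {3} 3 e))
      (trans (cong (λ (i , j) → combine i j) (edge′-inj eq)) (combine-remQuot {3} 3 f))

    edge-surj : ∀ e → ∃ λ f → edge f ≡ e
    edge-surj e with i , j , 0F , eq ← arc-surj e = combine i j , trans (cong edge′ (remQuot-combine i j)) eq

  realises-C₄⁴ : Frame S 2 2 → Realises tail head C₄⁴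
  realises-C₄⁴ F = record
    { vertex = vertex ; vertex-inj = inj ; vertex-surj = surj
    ; edge = edge
    ; edge-inj = edge-inj
    ; edge-surj = edge-surj
    ; ends-match = match
    }
    where
    open Frame F
    vertex : Fin 4 → Fin n ⊎ Fin n
    vertex 0F = inj₁ (left 0F)
    vertex 1F = inj₂ (right 0F)
    vertex 2F = inj₁ (left 1F)
    vertex 3F = inj₂ (right 1F)

    inj : ∀ {u v} → vertex u ≡ vertex v → u ≡ v
    inj {0F} {0F} _  = refl
    inj {0F} {2F} eq = case left-inj (inj₁-injective eq) of λ ()
    inj {0F} {3F} ()
    inj {1F} {1F} _  = refl
    inj {1F} {3F} eq = case right-inj (inj₂-injective eq) of λ ()
    inj {2F} {0F} eq = case left-inj (inj₁-injective eq) of λ ()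
    inj {2F} {2F} _  = refl
    inj {2F} {3F} ()
    inj {3F} {1F} eq = case right-inj (inj₂-injective eq) of λ ()
    inj {3F} {3F} _  = refl

    surj : ∀ x → ∃ λ v → vertex v ≡ x
    surj (inj₁ x) with left-surj x
    ... | 0F , refl = 0F , refl
    ... | 1F , refl = 2F , refl
    surj (inj₂ x) with right-surj x
    ... | 0F , refl = 1F , refl
    ... | 1F , refl = 3F , refl

    corner : Fin 4 → Fin 2 × Fin 2
    corner 0F = 0F , 0F
    corner 1F = 1F , 0F
    corner 2F = 1F , 1F
    corner 3F = 0F , 1F

    side : Fin 2 × Fin 2 → Fin 4
    side (0F , 0F) = 0F
    side (1F , 0F) = 1F
    side (1F , 1F) = 2F
    side (0F , 1F) = 3F

    side-corner : ∀ q → side (corner q) ≡ q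
    side-corner 0F = refl
    side-corner 1F = refl
    side-corner 2F = refl
    side-corner 3F = refl

    corner-side : ∀ p → corner (side p) ≡ p
    corner-side (0F , 0F) = refl
    corner-side (1F , 0F) = refl
    corner-side (1F , 1F) = refl
    corner-side (0F , 1F) = refl

    arc′ : Fin 2 × Fin 2 → Fin 2 → Fin ε
    arc′ (i , j) = arc i j

    edge′ : Fin 4 × Fin 2 → Fin ε
    edge′ (q , b) = arc′ (corner q) b

    edge : Fin 8 → Fin ε
    edge e = edge′ (remQuot {4} 2 e)

    arc′-inj : ∀ {p q b c} → arc′ p b ≡ arc′ q c → p ≡ q
    arc′-inj eq = cong₂ _,_
      (left-inj (trans (sym (arc-tail _ _ _)) (trans (cong tail eq) (arc-tail _ _ _))))
      (right-inj (trans (sym (arc-head _ _ _)) (trans (cong head eq) (arc-head _ _ _))))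

    edge′-inj : ∀ {p q} → edge′ p ≡ edge′ q → p ≡ q
    edge′-inj {q , b} {r , c} eq
      with refl ← trans (sym (side-corner q)) (trans (cong side (arc′-inj eq)) (side-corner r)) =
      cong (q ,_) (arc-inj eq)

    edge-inj : ∀ {e f} → edge e ≡ edge f → e ≡ f
    edge-inj {e} {f} eq = trans (sym (combine-remQuot {4} 2 e))
      (trans (cong (λ (i , j) → combine i j) (edge′-inj {remQuot {4} 2 e} {remQuot {4} 2 f} eq)) (combine-remQuot {4} 2 f))

    edge-surj : ∀ e → ∃ λ f → edge f ≡ e
    edge-surj e with i , j , b , eq ← arc-surj e =
      combine (side (i , j)) b ,
      trans (cong edge′ (remQuot-combine (side (i , j)) b)) (trans (cong (λ p → arc′ p b) (corner-side (i , j))) eq)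

    match : ∀ e →
      Spans (vertex (proj₁ (ends C₄⁴ e))) (vertex (proj₂ (ends C₄⁴ e))) (tail (edge e)) (head (edge e))
    match 0F = inj₁ (cong inj₁ (sym (arc-tail _ _ _)) , cong inj₂ (sym (arc-head _ _ _)))
    match 1F = inj₁ (cong inj₁ (sym (arc-tail _ _ _)) , cong inj₂ (sym (arc-head _ _ _)))
    match 2F = inj₂ (cong inj₂ (sym (arc-head _ _ _)) , cong inj₁ (sym (arc-tail _ _ _)))
    match 3F = inj₂ (cong inj₂ (sym (arc-head _ _ _)) , cong inj₁ (sym (arc-tail _ _ _)))
    match 4F = inj₁ (cong inj₁ (sym (arc-tail _ _ _)) , cong inj₂ (sym (arc-head _ _ _)))
    match 5F = inj₁ (cong inj₁ (sym (arc-tail _ _ _)) , cong inj₂ (sym (arc-head _ _ _)))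
    match (suc (suc (suc (suc (suc (suc 0F)))))) = inj₂ (cong inj₂ (sym (arc-head _ _ _)) , cong inj₁ (sym (arc-tail _ _ _)))
    match (suc (suc (suc (suc (suc (suc 1F)))))) = inj₂ (cong inj₂ (sym (arc-head _ _ _)) , cong inj₁ (sym (arc-tail _ _ _)))

  realises-C₄² : DoubledPair S → Realises tail head C₄²
  realises-C₄² D = record
    { vertex = vertex ; vertex-inj = inj ; vertex-surj = surj
    ; edge = List.lookup es
    ; edge-inj = lookup-injective unique
    ; edge-surj = λ e → let p = found (edges e) in index p , sym (lookup-index p)
    ; ends-match = match
    }
    where
    open DoubledPair D
    es : List (Fin ε)
    es = a ∷ a′ ∷ d ∷ b ∷ b′ ∷ c ∷ []

    found : ∀ {e} → e ∈ˡ (c ∷ d ∷ a ∷ a′ ∷ b ∷ b′ ∷ []) → e ∈ˡ es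
    found (here p)                                 = there (there (there (there (there (here p)))))
    found (there (here p))                         = there (there (here p))
    found (there (there (here p)))                 = here p
    found (there (there (there (here p))))         = there (here p)
    found (there (there (there (there (here p))))) = there (there (there (here p)))
    found (there (there (there (there (there (here p)))))) = there (there (there (there (here p))))

    v≠w : ∀ {x y} → tail x ≡ v → tail y ≡ w → x ≢ y
    v≠w p q refl = v≢w (trans (sym p) q)

    c≠d : ∀ {x y} → head x ≡ head c → head y ≡ head d → x ≢ y
    c≠d p q refl = c≢d-head (trans (sym p) q)

    unique : Unique es
    unique =
        (a≢a′ ∷ v≠w a-tail d-tail ∷ v≠w a-tail b-tail ∷ v≠w a-tail b′-tail ∷ (c≠d refl a-head ∘ sym) ∷ [])
      ∷ (v≠w a′-tail d-tail ∷ v≠w a′-tail b-tail ∷ v≠w a′-tail b′-tail ∷ (c≠d refl a′-head ∘ sym) ∷ [])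
      ∷ ((c≠d b-head refl ∘ sym) ∷ (c≠d b′-head refl ∘ sym) ∷ (v≠w c-tail d-tail ∘ sym) ∷ [])
      ∷ (b≢b′ ∷ (v≠w c-tail b-tail ∘ sym) ∷ [])
      ∷ ((v≠w c-tail b′-tail ∘ sym) ∷ [])
      ∷ [] ∷ []

    vertex : Fin 4 → Fin n ⊎ Fin n
    vertex 0F = inj₁ v
    vertex 1F = inj₂ (head d)
    vertex 2F = inj₁ w
    vertex 3F = inj₂ (head c)

    inj : ∀ {x y} → vertex x ≡ vertex y → x ≡ y
    inj {0F} {0F} _  = refl
    inj {0F} {2F} eq = contradiction (inj₁-injective eq) v≢w
    inj {0F} {3F} ()
    inj {1F} {1F} _  = refl
    inj {1F} {3F} eq = contradiction (sym (inj₂-injective eq)) c≢d-head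
    inj {2F} {0F} eq = contradiction (sym (inj₁-injective eq)) v≢w
    inj {2F} {2F} _  = refl
    inj {2F} {3F} ()
    inj {3F} {1F} eq = contradiction (inj₂-injective eq) c≢d-head
    inj {3F} {3F} _  = refl

    pick : ∀ {u} → u ≡ v ⊎ u ≡ w → Fin ε
    pick (inj₁ _) = c
    pick (inj₂ _) = d

    pick-inj : ∀ {x y} → head (pick (vertices x)) ≡ head (pick (vertices y)) → x ≡ y
    pick-inj {x} {y} eq with vertices x | vertices y
    ... | inj₁ p | inj₁ q = trans p (sym q)
    ... | inj₂ p | inj₂ q = trans p (sym q)
    ... | inj₁ p | inj₂ q = contradiction eq c≢d-head
    ... | inj₂ p | inj₁ q = contradiction (sym eq) c≢d-head

    surj : ∀ x → ∃ λ u → vertex u ≡ x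
    surj (inj₁ x) with vertices x
    ... | inj₁ refl = 0F , refl
    ... | inj₂ refl = 2F , refl
    -- The heads of `c` and `d` exhaust the second class because it has as many vertices as the
    -- first.
    surj (inj₂ x) with y , refl ← injective⇒surjective (λ u → head (pick (vertices u))) pick-inj x
      with vertices y
    ... | inj₁ _ = 3F , refl
    ... | inj₂ _ = 1F , refl

    match : ∀ e →
      Spans (vertex (proj₁ (ends C₄² e))) (vertex (proj₂ (ends C₄² e))) (tail (List.lookup es e)) (head (List.lookup es e))
    match 0F = inj₁ (cong inj₁ (sym a-tail) , cong inj₂ (sym a-head))
    match 1F = inj₁ (cong inj₁ (sym a′-tail) , cong inj₂ (sym a′-head))
    match 2F = inj₂ (refl , cong inj₁ (sym d-tail))
    match 3F = inj₁ (cong inj₁ (sym b-tail) , cong inj₂ (sym b-head))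
    match 4F = inj₁ (cong inj₁ (sym b′-tail) , cong inj₂ (sym b′-head))
    match 5F = inj₂ (refl , cong inj₁ (sym c-tail))

  module RotationCycle (R : Rotation S) (v₀ : Fin n) where
    open Setting S using (connected)
    open Rotation R

    -- A position on the cycle with its direction of travel: `inj₁ v` is at `v`, about to traverse
    -- `outer v`; `inj₂ v` is at the head of `inner v`, about to traverse that edge back to `v`.
    Flag : Set
    Flag = Fin n ⊎ Fin n

    turn : Flag → Flag
    turn (inj₁ v) = inj₂ (step v)
    turn (inj₂ v) = inj₁ v

    turn-inj : ∀ {x y} → turn x ≡ turn y → x ≡ y
    turn-inj {inj₁ _} {inj₁ _} eq = cong inj₁ (step-inj (inj₂-injective eq))
    turn-inj {inj₂ _} {inj₂ _} eq = cong inj₂ (inj₁-injective eq)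

    x₀ : Flag
    x₀ = inj₁ v₀

    fold-even : ∀ k v → fold (inj₁ v) turn (k + k) ≡ inj₁ (fold v step k)
    fold-even zero    v = refl
    fold-even (suc k) v rewrite +-suc k k | fold-even k v = refl

    opaque
      period : ∃ λ k → fold x₀ turn (suc k) ≡ x₀ × (∀ {i} → i < k → fold x₀ turn (suc i) ≢ x₀)
      period with k , eq ← periodic step step-inj v₀ =
        -- Returning after `suc k` steps means returning after `suc k + suc k` turns; the search
        -- counts turns beyond the first.
        least (λ i → ≡-dec _≟_ _≟_ (fold x₀ turn (suc i)) x₀) (k + suc k)
              (trans (fold-even (suc k) v₀) (cong inj₁ eq))

    k : ℕ
    k = proj₁ period

    returns : fold x₀ turn (suc k) ≡ x₀
    returns = proj₁ (proj₂ period)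

    open Orbit turn x₀ k returns

    on-turn-back : ∀ {y} → On (turn y) → On y
    on-turn-back = on-back turn-inj

    -- The orbit is closed forwards and backwards under `turn`, hence along all edges, and
    -- connectedness applies.
    all-on : ∀ y → On y
    all-on (inj₁ v) = connected (λ v → On (inj₁ v)) (λ w → ∃ λ v → head (inner v) ≡ w × On (inj₂ v))
                        forth back (v₀ , on-start) v
      where
      forth : ∀ e → On (inj₁ (tail e)) → ∃ λ v → head (inner v) ≡ head e × On (inj₂ v)
      forth e o with edges e
      ... | inj₁ eq = tail e , cong head (sym eq) , on-turn-back o
      ... | inj₂ eq = step (tail e) , trans (sym (outer-head (tail e))) (cong head (sym eq)) , on-step o
      back : ∀ e → (∃ λ v → head (inner v) ≡ head e × On (inj₂ v)) → On (inj₁ (tail e))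
      back e (v , hv , o) with edges e
      ... | inj₁ eq = subst (On ∘ inj₁) (head-inner (trans hv (cong head eq))) (on-step o)
      ... | inj₂ eq = on-turn-back (subst (On ∘ inj₂) (head-inner (trans hv (trans (cong head eq) (outer-head (tail e))))) o)
    all-on (inj₂ v) = on-turn-back (all-on (inj₁ v))

    distinct : ∀ {i j} → j < suc k → fold x₀ turn i ≡ fold x₀ turn j → ¬ (i < j)
    distinct {i} {j} (s≤s j≤k) eq i<j with d , refl ← m≤n⇒∃[o]m+o≡n i<j =
      proj₂ (proj₂ period) (≤-trans (s≤s (m≤n+m d i)) j≤k)
        (sym (fold-injective turn turn-inj i
          (trans eq (trans (cong (fold x₀ turn) (sym (+-suc i d))) (fold-+ x₀ turn i)))))

    fold-turn-inj : ∀ {i j} → i < suc k → j < suc k → fold x₀ turn i ≡ fold x₀ turn j → i ≡ j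
    fold-turn-inj {i} {j} i<K j<K eq with <-cmp i j
    ... | tri< i<j _ _ = contradiction i<j (distinct j<K eq)
    ... | tri≈ _ i≡j _ = i≡j
    ... | tri> _ _ j<i = contradiction j<i (distinct i<K (sym eq))

    halve : ∀ k → (∃ λ h → k ≡ h + h) ⊎ (∃ λ h → k ≡ suc (h + h))
    halve zero = inj₁ (0 , refl)
    halve (suc k) with halve k
    ... | inj₁ (h , refl) = inj₂ (h , refl)
    ... | inj₂ (h , refl) = inj₁ (suc h , cong suc (sym (+-suc h h)))

    -- An odd number of turns ends in the other class, and two turns make one `step`, which has no
    -- fixed point.
    half : ∃ λ h → suc k ≡ 2 * h × 2 ≤ h
    half with halve (suc k)
    ... | inj₂ (h , eq) = case trans (sym (cong turn (fold-even h v₀))) (trans (cong (fold x₀ turn) (sym eq)) returns) of λ ()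
    ... | inj₁ (1 , eq) = contradiction
            (inj₁-injective (trans (cong (fold x₀ turn) (sym eq)) returns)) (step-≢ v₀)
    ... | inj₁ (suc (suc h) , eq) = suc (suc h) , trans eq
            (cong (λ z → suc (suc h) + suc (suc z)) (+-comm 0 h)) , s≤s (s≤s z≤n)

    flag-vertex : Flag → Fin n ⊎ Fin n
    flag-vertex (inj₁ v) = inj₁ v
    flag-vertex (inj₂ v) = inj₂ (head (inner v))

    flag-vertex-inj : ∀ {x y} → flag-vertex x ≡ flag-vertex y → x ≡ y
    flag-vertex-inj {inj₁ _} {inj₁ _} eq = cong inj₁ (inj₁-injective eq)
    flag-vertex-inj {inj₂ _} {inj₂ _} eq = cong inj₂ (head-inner (inj₂-injective eq))

    flag-vertex-surj : ∀ y → ∃ λ x → flag-vertex x ≡ y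
    flag-vertex-surj (inj₁ v) = inj₁ v , refl
    flag-vertex-surj (inj₂ w) with v , eq ← injective⇒surjective (head ∘ inner) head-inner w =
      inj₂ v , cong inj₂ eq

    flag-edge : Flag → Fin ε
    flag-edge (inj₁ v) = outer v
    flag-edge (inj₂ v) = inner v

    flag-edge-inj : ∀ {x y} → flag-edge x ≡ flag-edge y → x ≡ y
    flag-edge-inj {inj₁ u} {inj₁ v} eq = cong inj₁ (trans (sym (outer-tail u)) (trans (cong tail eq) (outer-tail v)))
    flag-edge-inj {inj₂ u} {inj₂ v} eq = cong inj₂ (trans (sym (inner-tail u)) (trans (cong tail eq) (inner-tail v)))
    flag-edge-inj {inj₁ u} {inj₂ v} eq with refl ← trans (sym (outer-tail u)) (trans (cong tail eq) (inner-tail v)) =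
      contradiction (sym eq) (inner≢outer u)
    flag-edge-inj {inj₂ u} {inj₁ v} eq with refl ← trans (sym (inner-tail u)) (trans (cong tail eq) (outer-tail v)) =
      contradiction eq (inner≢outer u)

    flag-edge-surj : ∀ e → ∃ λ x → flag-edge x ≡ e
    flag-edge-surj e with edges e
    ... | inj₁ eq = inj₂ (tail e) , sym eq
    ... | inj₂ eq = inj₁ (tail e) , sym eq

    flag-match : ∀ x →
      Spans (flag-vertex x) (flag-vertex (turn x)) (tail (flag-edge x)) (head (flag-edge x))
    flag-match (inj₁ v) = inj₁ (cong inj₁ (sym (outer-tail v)) , cong inj₂ (sym (outer-head v)))
    flag-match (inj₂ v) = inj₂ (refl , cong inj₁ (sym (inner-tail v)))

    realises-EvenCycle : ∃ λ h → ∃ λ (2≤h : 2 ≤ h) → Realises tail head (EvenCycle h 2≤h)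
    realises-EvenCycle with h , K≡ , 2≤h ← half = h , 2≤h , record
      { vertex = flag-vertex ∘ position
      ; vertex-inj = position-inj ∘ flag-vertex-inj
      ; vertex-surj = λ y → let x , eq = flag-vertex-surj y; i , eq′ = position-surj x in
                            i , trans (cong flag-vertex eq′) eq
      ; edge = flag-edge ∘ position
      ; edge-inj = position-inj ∘ flag-edge-inj
      ; edge-surj = λ y → let x , eq = flag-edge-surj y; i , eq′ = position-surj x in
                            i , trans (cong flag-edge eq′) eq
      ; ends-match = λ i → subst
          (λ x → Spans (flag-vertex (position i)) (flag-vertex x)
                       (tail (flag-edge (position i))) (head (flag-edge (position i))))
          (sym (position-next {{_}} i)) (flag-match (position i))
      }
      where
      position : Fin (2 * h) → Flag
      position i = fold x₀ turn (toℕ i)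

      position-inj : ∀ {i j} → position i ≡ position j → i ≡ j
      position-inj {i} {j} eq = toℕ-injective
        (fold-turn-inj (subst (toℕ i <_) (sym K≡) (toℕ<n i)) (subst (toℕ j <_) (sym K≡) (toℕ<n j)) eq)

      position-surj : ∀ x → ∃ λ i → position i ≡ x
      position-surj x with j , j<K , eq ← all-on x =
        fromℕ< (subst (j <_) K≡ j<K) , trans (cong (fold x₀ turn) (toℕ-fromℕ< (subst (j <_) K≡ j<K))) eq

      position-next : .{{_ : NonZero (2 * h)}} (i : Fin (2 * h)) → position (next i) ≡ turn (position i)
      position-next i with toℕ-next i
      ... | inj₁ (_ , eq) = cong (fold x₀ turn) eq
      ... | inj₂ (last , eq) = trans (cong (fold x₀ turn) eq)
              (sym (trans (cong (fold x₀ turn) (trans last (sym K≡))) returns))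

-- Case distinction by the number of vertices and the kind of edges.

module _ {n ε : ℕ} {tail head : Fin ε → Fin n} (S : Setting tail head) where
  open Setting S

  two⇒¬one : ∀ {e} → Two e → ¬ One e
  two⇒¬one t o with v , ne ← sel-distinct t =
    ne (o (sel-selects t 0F) (sel-selects t 1F) (sel-∋ t 0F) (sel-∋ t 1F) v)

  module _ (classify : ∀ e → One e ⊎ Two e) where

    one? : ∀ e → Dec (One e)
    one? e with classify e
    ... | inj₁ o = yes o
    ... | inj₂ t = no (two⇒¬one t)

    one-or-all-two : ∃ One ⊎ (∀ e → Two e)
    one-or-all-two with any? one?
    ... | yes found = inj₁ found
    ... | no none   = inj₂ λ e → [ (λ o → contradiction (e , o) none) , (λ t → t) ]′ (classify e)

distinct₂ : ∀ {n} (u : Fin (suc (suc n))) → ∃ λ v → v ≢ u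
distinct₂ 0F      = 1F , λ ()
distinct₂ (suc _) = 0F , λ ()

distinct₃ : ∀ {n} (u v : Fin (suc (suc (suc n)))) → ∃ λ w → w ≢ u × w ≢ v
distinct₃ 0F            0F            = 1F , (λ ()) , λ ()
distinct₃ 0F            1F            = 2F , (λ ()) , λ ()
distinct₃ 0F            (suc (suc _)) = 1F , (λ ()) , λ ()
distinct₃ 1F            0F            = 2F , (λ ()) , λ ()
distinct₃ (suc (suc _)) 0F            = 1F , (λ ()) , λ ()
distinct₃ (suc _)       (suc _)       = 0F , (λ ()) , λ ()

classification : ∀ {n ε} {tail head : Fin ε → Fin n} (S : Setting tail head) →
  (∀ e → Setting.One S e ⊎ Setting.Two S e) →
  (∀ {f u v} → Selections.Selection tail head f → Setting.One S (f u) → Setting.Two S (f v) → ⊥) →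
  Fin n → ∃ (Selections.Selection tail head) →
  (1 ≤ ε × Realises tail head (K₂* ε))
  ⊎ Realises tail head C₄²
  ⊎ Realises tail head C₄⁴
  ⊎ Realises tail head (K 3 3)
  ⊎ (∃ λ h → ∃ λ (2≤h : 2 ≤ h) → Realises tail head (EvenCycle h 2≤h))
classification {suc zero} {ε} S _ _ _ (m , _) = inj₁ (inhabited (m 0F) , realises-K₂* _ _)
  where
  inhabited : ∀ {k} → Fin k → 1 ≤ k
  inhabited {suc _} _ = s≤s z≤n
classification {suc (suc n)} {tail = tail} S classify unmixed v₀ (m′ , M′) with one-or-all-two S classify
classification {suc (suc zero)}    S classify unmixed v₀ (m′ , M′) | inj₂ two =
  inj₂ (inj₂ (inj₁ (realises-C₄⁴ S (Exactly2.frame₂ S two M′))))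
classification {suc (suc (suc _))} S classify unmixed v₀ (m′ , M′) | inj₂ two =
  inj₂ (inj₂ (inj₂ (inj₁ (realises-K₃₃ S (AtLeastThree.frame₃ S two distinct₃ v₀ M′)))))
-- The given matching is exchanged for one through the 1-matching edge `e`; all its edges are then
-- 1-matching edges.
classification {suc (suc n)} {tail = tail} S classify unmixed v₀ _ | inj₁ (e , o)
  with m , M , e∈m ← Setting.covered S e = result
  where
  open Setting S

  all-one : ∀ v → One (m v)
  all-one v with classify (m v)
  ... | inj₁ o′ = o′
  ... | inj₂ t  = ⊥-elim (unmixed {u = tail e} M (subst One (sym e∈m) o) t)

  single : ∀ {f v} → Selection f → f v ≡ m v → f ≗ m
  single {f} {v} F eq = all-one v F M (through F eq) (∈ₛ-self M v)

  open SingleThrough S M single distinct₂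

  result : _
  result with any? (λ x → ¬? (x ≟ m (tail x)) ×-dec ¬? (x ≟ out (tail x)))
  ... | yes (x , x≢m , x≢out) =
    inj₂ (inj₁ (realises-C₄² S (Doubled.doubledPair classify unmixed refl x≢m x≢out)))
  ... | no none =
    inj₂ (inj₂ (inj₂ (inj₂ (RotationCycle.realises-EvenCycle S
      (rotation λ x x≢m → decidable-stable (x ≟ out (tail x)) λ x≢out → none (x , x≢m , x≢out)) v₀))))

-- Numbering the colour classes; perfect matchings versus selections.

record Labelling (G : Multigraph) : Set where
  field
    n           : ℕ
    tail head   : Edge G → Fin n
    vertex      : Fin n ⊎ Fin n → Vertex G
    vertex-inj  : ∀ {x y} → vertex x ≡ vertex y → x ≡ y
    vertex-surj : ∀ v → ∃ λ x → vertex x ≡ v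
    incident⁺   : ∀ {x e} → x ≡ inj₁ (tail e) ⊎ x ≡ inj₂ (head e) → Incident G (vertex x) e
    incident⁻   : ∀ {x e} → Incident G (vertex x) e → x ≡ inj₁ (tail e) ⊎ x ≡ inj₂ (head e)

module _ (G : Multigraph) (side : Vertex G → Bool)
         (sides : ∀ e → side (proj₁ (ends G e)) ≢ side (proj₂ (ends G e)))
         {M : Subset (nE G)} (PM : PerfectMatching G M) where

  private
    split : ∀ e → ∃ λ a → ∃ λ b → side a ≡ true × side b ≡ false ×
            (∀ {v} → v ≡ a ⊎ v ≡ b → Incident G v e) × (∀ {v} → Incident G v e → v ≡ a ⊎ v ≡ b)
    split e with side (proj₁ (ends G e)) in p | side (proj₂ (ends G e)) in q | sides e
    ... | true  | true  | ne = contradiction refl ne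
    ... | false | false | ne = contradiction refl ne
    ... | true  | false | _  = _ , _ , p , q , (λ i → i) , (λ i → i)
    ... | false | true  | _  = _ , _ , q , p , Sum.swap , Sum.swap

    a-end b-end : Edge G → Vertex G
    a-end e = proj₁ (split e)
    b-end e = proj₁ (proj₂ (split e))

    a-side : ∀ e → side (a-end e) ≡ true
    a-side e = proj₁ (proj₂ (proj₂ (split e)))

    b-side : ∀ e → side (b-end e) ≡ false
    b-side e = proj₁ (proj₂ (proj₂ (proj₂ (split e))))

    incident-ends : ∀ {v} e → v ≡ a-end e ⊎ v ≡ b-end e → Incident G v e
    incident-ends e = proj₁ (proj₂ (proj₂ (proj₂ (proj₂ (split e)))))

    ends-incident : ∀ {v} e → Incident G v e → v ≡ a-end e ⊎ v ≡ b-end e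
    ends-incident e = proj₂ (proj₂ (proj₂ (proj₂ (proj₂ (split e)))))

    true≢false : ∀ {u v} → side u ≡ true → side v ≡ false → u ≢ v
    true≢false p q refl with () ← trans (sym p) q

    is-a : ∀ {v} e → side v ≡ true → Incident G v e → v ≡ a-end e
    is-a e s i with ends-incident e i
    ... | inj₁ eq = eq
    ... | inj₂ eq = contradiction eq (true≢false s (b-side e))

    is-b : ∀ {v} e → side v ≡ false → Incident G v e → v ≡ b-end e
    is-b e s i with ends-incident e i
    ... | inj₂ eq = eq
    ... | inj₁ eq = contradiction (sym eq) (true≢false (a-side e) s)

    class : List (Vertex G)
    class = filter (λ v → side v ≟ᵇ true) (allFin (nV G))

    n : ℕ
    n = length class

    left : Fin n → Vertex G
    left = List.lookup class

    left-inj : ∀ {i j} → left i ≡ left j → i ≡ j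
    left-inj = lookup-injective (filter⁺ (λ v → side v ≟ᵇ true) (allFin⁺ (nV G)))

    left-side : ∀ i → side (left i) ≡ true
    left-side i = proj₂ (∈-filter⁻ (λ v → side v ≟ᵇ true) {xs = allFin (nV G)} (∈-lookup i))

    left-surj : ∀ {v} → side v ≡ true → ∃ λ i → left i ≡ v
    left-surj {v} s = let p = ∈-filter⁺ (λ v → side v ≟ᵇ true) (∈-allFin v) s in index p , sym (lookup-index p)

    mate : Vertex G → Edge G
    mate v = proj₁ (PM v)

    mate-incident : ∀ v → Incident G v (mate v)
    mate-incident v = proj₂ (proj₁ (proj₂ (PM v)))

    mate-unique : ∀ {u v} → Incident G u (mate v) → mate u ≡ mate v
    mate-unique {u} {v} i = proj₂ (proj₂ (PM u)) (proj₁ (proj₁ (proj₂ (PM v))) , i)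

    -- The second class is numbered by matching partners, so the two classes have equal size without
    -- any counting.
    right : Fin n → Vertex G
    right i = b-end (mate (left i))

    right-side : ∀ i → side (right i) ≡ false
    right-side i = b-side (mate (left i))

    left-a : ∀ i → left i ≡ a-end (mate (left i))
    left-a i = is-a (mate (left i)) (left-side i) (mate-incident (left i))

    right-inj : ∀ {i j} → right i ≡ right j → i ≡ j
    right-inj {i} {j} eq = left-inj (trans (left-a i) (trans (cong a-end same) (sym (left-a j))))
      where
      same : mate (left i) ≡ mate (left j)
      same = trans (sym (mate-unique (incident-ends (mate (left i)) (inj₂ refl))))
                   (mate-unique (incident-ends (mate (left j)) (inj₂ eq)))

    right-surj : ∀ {v} → side v ≡ false → ∃ λ i → right i ≡ v
    right-surj {v} s with i , eq ← left-surj (a-side (mate v)) = i ,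
      trans (cong b-end (mate-unique (subst (λ u → Incident G u (mate v)) (sym eq) (incident-ends (mate v) (inj₁ refl)))))
            (sym (is-b (mate v) s (mate-incident v)))

  labelling : Labelling G
  labelling = record
    { n = n
    ; tail = tail ; head = head
    ; vertex = vertex ; vertex-inj = vertex-inj ; vertex-surj = vertex-surj
    ; incident⁺ = λ { {e = e} (inj₁ refl) → incident-ends e (inj₁ (proj₂ (left-surj (a-side e))))
                    ; {e = e} (inj₂ refl) → incident-ends e (inj₂ (proj₂ (right-surj (b-side e)))) }
    ; incident⁻ = incident⁻
    }
    where
    tail head : Edge G → Fin n
    tail e = proj₁ (left-surj (a-side e))
    head e = proj₁ (right-surj (b-side e))

    vertex : Fin n ⊎ Fin n → Vertex G
    vertex (inj₁ i) = left i
    vertex (inj₂ i) = right i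

    vertex-inj : ∀ {x y} → vertex x ≡ vertex y → x ≡ y
    vertex-inj {inj₁ i} {inj₁ j} eq = cong inj₁ (left-inj eq)
    vertex-inj {inj₂ i} {inj₂ j} eq = cong inj₂ (right-inj eq)
    vertex-inj {inj₁ i} {inj₂ j} eq = contradiction eq (true≢false (left-side i) (right-side j))
    vertex-inj {inj₂ i} {inj₁ j} eq = contradiction (sym eq) (true≢false (left-side j) (right-side i))

    vertex-surj : ∀ v → ∃ λ x → vertex x ≡ v
    vertex-surj v with side v in s
    ... | true  = let i , eq = left-surj s in inj₁ i , eq
    ... | false = let i , eq = right-surj s in inj₂ i , eq

    incident⁻ : ∀ {x e} → Incident G (vertex x) e → x ≡ inj₁ (tail e) ⊎ x ≡ inj₂ (head e)
    incident⁻ {inj₁ i} {e} inc = inj₁ (cong inj₁ (left-inj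
      (trans (is-a e (left-side i) inc) (sym (proj₂ (left-surj (a-side e)))))))
    incident⁻ {inj₂ i} {e} inc = inj₂ (cong inj₂ (right-inj
      (trans (is-b e (right-side i) inc) (sym (proj₂ (right-surj (b-side e)))))))

bijection : ∀ {A B : Set} (f : A → B) → (∀ {x y} → f x ≡ f y → x ≡ y) → (∀ y → ∃ λ x → f x ≡ y) → B ↔ A
bijection f inj surj = mk↔ₛ′ (proj₁ ∘ surj) f (λ x → inj (proj₂ (surj (f x)))) (proj₂ ∘ surj)

module _ {G : Multigraph} (L : Labelling G) where
  open Labelling L

  realises⇒≅ : ∀ {H} → Realises tail head H → G ≅ H
  realises⇒≅ {H} R = record
    { onVertices = bijection (vertex ∘ R.vertex) (R.vertex-inj ∘ vertex-inj) surj
    ; onEdges    = bijection R.edge R.edge-inj R.edge-surj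
    ; incidence  = λ v e → let u , eq = surj v; f , eq′ = R.edge-surj e in
        mk⇔ (λ i → to (subst₂ (Incident G) (sym eq) (sym eq′) i))
            (λ i → subst₂ (Incident G) eq eq′ (from i))
    }
    where
    module R = Realises R
    surj : ∀ v → ∃ λ u → vertex (R.vertex u) ≡ v
    surj v with x , refl ← vertex-surj v with u , refl ← R.vertex-surj x = u , refl

    to : ∀ {u f} → Incident G (vertex (R.vertex u)) (R.edge f) → Incident H u f
    to {u} {f} i with incident⁻ i | R.ends-match f
    ... | inj₁ p | inj₁ (q , _) = inj₁ (R.vertex-inj (trans p (sym q)))
    ... | inj₁ p | inj₂ (_ , q) = inj₂ (R.vertex-inj (trans p (sym q)))
    ... | inj₂ p | inj₁ (_ , q) = inj₂ (R.vertex-inj (trans p (sym q)))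
    ... | inj₂ p | inj₂ (q , _) = inj₁ (R.vertex-inj (trans p (sym q)))

    from : ∀ {u f} → Incident H u f → Incident G (vertex (R.vertex u)) (R.edge f)
    from {u} {f} i with i | R.ends-match f
    ... | inj₁ refl | inj₁ (q , _) = incident⁺ (inj₁ q)
    ... | inj₁ refl | inj₂ (q , _) = incident⁺ (inj₂ q)
    ... | inj₂ refl | inj₁ (_ , q) = incident⁺ (inj₂ q)
    ... | inj₂ refl | inj₂ (_ , q) = incident⁺ (inj₁ q)

  open Selections tail head

  toPM : (Fin n → Edge G) → Subset (nE G)
  toPM f = tabulate (λ e → does (f (tail e) ≟ e))

  ∈-toPM⁺ : ∀ f {e} → e ∈ₛ f → e ∈ toPM f
  ∈-toPM⁺ f {e} p = lookup⇒[]= e (toPM f) (trans (lookup∘tabulate _ e) (dec-true (f (tail e) ≟ e) p))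

  ∈-toPM⁻ : ∀ f {e} → e ∈ toPM f → e ∈ₛ f
  ∈-toPM⁻ f {e} p with f (tail e) ≟ e | trans (sym (lookup∘tabulate (λ e → does (f (tail e) ≟ e)) e)) ([]=⇒lookup p)
  ... | yes q | _ = q
  ... | no _  | ()

  ∈ₛ-unique : ∀ {f v e} → e ∈ₛ f → tail e ≡ v → f v ≡ e
  ∈ₛ-unique p refl = p

  toPM-perfect : ∀ {f} → Selection f → PerfectMatching G (toPM f)
  toPM-perfect {f} F v with vertex-surj v
  ... | inj₁ i , refl = f i , (∈-toPM⁺ f (∈ₛ-self F i) , incident⁺ (inj₁ (cong inj₁ (sym (tail-at F i))))) , unique
    where
    unique : ∀ {e} → e ∈ toPM f × Incident G (vertex (inj₁ i)) e → f i ≡ e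
    unique (e∈ , inc) with incident⁻ inc
    ... | inj₁ eq = ∈ₛ-unique {f} (∈-toPM⁻ f e∈) (sym (inj₁-injective eq))
  ... | inj₂ j , refl with i , eq ← injective⇒surjective (head ∘ f) (head-injective F) j =
    f i , (∈-toPM⁺ f (∈ₛ-self F i) , incident⁺ (inj₂ (cong inj₂ (sym eq)))) , unique
    where
    unique : ∀ {e} → e ∈ toPM f × Incident G (vertex (inj₂ j)) e → f i ≡ e
    unique {e} (e∈ , inc) with incident⁻ inc
    ... | inj₂ eq′ = trans (cong f (head-injective F (trans eq (trans (inj₂-injective eq′)
                       (cong head (sym (∈-toPM⁻ f e∈))))))) (∈-toPM⁻ f e∈)

  toPM-injective : ∀ {f g} → Selection f → Selection g → toPM f ≡ toPM g → f ≗ g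
  toPM-injective {f} {g} F G′ eq v =
    sym (∈ₛ-unique {g} (∈-toPM⁻ g (subst (f v ∈_) eq (∈-toPM⁺ f (∈ₛ-self F v)))) (tail-at F v))

  toPM-cong : ∀ {f g} → f ≗ g → toPM f ≡ toPM g
  toPM-cong {f} {g} eq = ⊆-antisym
    (λ p → ∈-toPM⁺ g (trans (sym (eq _)) (∈-toPM⁻ f p)))
    (λ p → ∈-toPM⁺ f (trans (eq _) (∈-toPM⁻ g p)))

  module _ {M : Subset (nE G)} (PM : PerfectMatching G M) where

    fromPM : Fin n → Edge G
    fromPM i = proj₁ (PM (vertex (inj₁ i)))

    private
      fromPM-∈ : ∀ i → fromPM i ∈ M
      fromPM-∈ i = proj₁ (proj₁ (proj₂ (PM (vertex (inj₁ i)))))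

    fromPM-selects : Selection fromPM
    fromPM-selects = selection tails heads
      where
      tails : ∀ i → tail (fromPM i) ≡ i
      tails i with incident⁻ (proj₂ (proj₁ (proj₂ (PM (vertex (inj₁ i))))))
      ... | inj₁ eq = sym (inj₁-injective eq)
      heads : ∀ {i j} → head (fromPM i) ≡ head (fromPM j) → i ≡ j
      heads {i} {j} eq = trans (sym (tails i)) (trans (cong tail same) (tails j))
        where
        same : fromPM i ≡ fromPM j
        same = let _ , _ , unique = PM (vertex (inj₂ (head (fromPM j)))) in
          trans (sym (unique (fromPM-∈ i , incident⁺ (inj₂ (cong inj₂ (sym eq))))))
                (unique (fromPM-∈ j , incident⁺ (inj₂ refl)))

    ∈-fromPM : ∀ {e} → e ∈ M → e ∈ₛ fromPM
    ∈-fromPM {e} p = proj₂ (proj₂ (PM (vertex (inj₁ (tail e))))) (p , incident⁺ (inj₁ refl))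

    toPM-fromPM : toPM fromPM ≡ M
    toPM-fromPM = ⊆-antisym (λ p → subst (_∈ M) (∈-toPM⁻ fromPM p) (fromPM-∈ _)) (∈-toPM⁺ fromPM ∘ ∈-fromPM)

  setting : MatchingCovered G → Setting tail head
  setting ((_ , path) , cover) = record { covered = covered ; connected = connected }
    where
    covered : ∀ e → ∃ λ f → Selection f × e ∈ₛ f
    covered e with M , PM , e∈M ← cover e = fromPM PM , fromPM-selects PM , ∈-fromPM PM e∈M

    -- `Q` and `R` combine to one predicate on vertices, which is carried along a path edge by edge.
    connected : (Q R : Fin n → Set) → (∀ e → Q (tail e) → R (head e)) →
                (∀ e → R (head e) → Q (tail e)) → ∃ Q → ∀ v → Q v
    connected Q R forth back (i , q) j =
      walk (path (vertex (inj₁ i)) (vertex (inj₁ j))) (inj₁ i) refl q (inj₁ j) refl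
      where
      QR : Fin n ⊎ Fin n → Set
      QR = [ Q , R ]′

      along : ∀ {x y e} → Incident G (vertex x) e → Incident G (vertex y) e → QR x → QR y
      along {e = e} i j p with incident⁻ i | incident⁻ j
      ... | inj₁ refl | inj₁ refl = p
      ... | inj₁ refl | inj₂ refl = forth e p
      ... | inj₂ refl | inj₁ refl = back e p
      ... | inj₂ refl | inj₂ refl = p

      walk : ∀ {u v} → Star (λ x y → ∃ λ e → Joins G e x y) u v →
             ∀ x → vertex x ≡ u → QR x → ∀ y → vertex y ≡ v → QR y
      walk Star.ε x refl p y eq = subst QR (vertex-inj (sym eq)) p
      walk (_◅_ {j = v} (e , joins) steps) x refl p y eq with z , refl ← vertex-surj v =
        walk steps z refl (along (proj₁ (incidences joins)) (proj₂ (incidences joins)) p) y eq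
        where
        incidences : ∀ {u v} → Joins G e u v → Incident G u e × Incident G v e
        incidences (inj₁ eq) = inj₁ (cong proj₁ (sym eq)) , inj₂ (cong proj₂ (sym eq))
        incidences (inj₂ eq) = inj₂ (cong proj₂ (sym eq)) , inj₁ (cong proj₁ (sym eq))

  module _ (covered : MatchingCovered G) where
    open Setting (setting covered) using (One; Two)

    ME₁⇒One : ∀ {e} → MatchingEdge 1 G e → One e
    ME₁⇒One (M ∷ [] , _ , _ , lists) {f} {g} F G′ e∈f e∈g
      with Equivalence.from (lists (toPM f)) (toPM-perfect F , ∈-toPM⁺ f e∈f)
         | Equivalence.from (lists (toPM g)) (toPM-perfect G′ , ∈-toPM⁺ g e∈g)
    ... | here p | here q = toPM-injective F G′ (trans p (sym q))

    ME₂⇒Two : ∀ {e} → MatchingEdge 2 G e → Two e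
    ME₂⇒Two {e} (M ∷ N ∷ [] , _ , (M≢N ∷ []) ∷ _ , lists) = record
      { sel = s ; sel-selects = selects ; sel-∋ = contains
      ; sel-distinct = distinct
      ; sel-only = only
      }
      where
      PM : PerfectMatching G M × e ∈ M
      PM = Equivalence.to (lists M) (here refl)
      PN : PerfectMatching G N × e ∈ N
      PN = Equivalence.to (lists N) (there (here refl))
      s : Fin 2 → Fin n → Edge G
      s 0F = fromPM (proj₁ PM)
      s 1F = fromPM (proj₁ PN)
      selects : ∀ b → Selection (s b)
      selects 0F = fromPM-selects (proj₁ PM)
      selects 1F = fromPM-selects (proj₁ PN)
      contains : ∀ b → e ∈ₛ s b
      contains 0F = ∈-fromPM (proj₁ PM) (proj₂ PM)
      contains 1F = ∈-fromPM (proj₁ PN) (proj₂ PN)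
      distinct : Differ (s 0F) (s 1F)
      distinct with differ-or-≗ (s 0F) (s 1F)
      ... | inj₁ d  = d
      ... | inj₂ eq = contradiction (trans (sym (toPM-fromPM (proj₁ PM)))
                        (trans (toPM-cong eq) (toPM-fromPM (proj₁ PN)))) M≢N
      only : ∀ {f} → Selection f → e ∈ₛ f → ∃ λ b → f ≗ s b
      only {f} F e∈f with Equivalence.from (lists (toPM f)) (toPM-perfect F , ∈-toPM⁺ f e∈f)
      ... | here p         = 0F , toPM-injective F (selects 0F) (trans p (sym (toPM-fromPM (proj₁ PM))))
      ... | there (here p) = 1F , toPM-injective F (selects 1F) (trans p (sym (toPM-fromPM (proj₁ PN))))

-- Graphs in `𝔅` are listed.

Listed : Multigraph → Set
Listed G = (∃ λ m → 1 ≤ m × G ≅ K₂* m)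
         ⊎ G ≅ C₄²
         ⊎ G ≅ C₄⁴
         ⊎ G ≅ K 3 3
         ⊎ (∃ λ n → ∃ λ (2≤n : 2 ≤ n) → G ≅ EvenCycle n 2≤n)

𝔅⇒listed : ∀ {G} → Bipartite G → MatchingCovered G → 𝔅 G → Listed G
𝔅⇒listed {G} (side , sides) covered@((v , _) , _) B =
  [ (λ (1≤ , R) → inj₁ (nE G , 1≤ , realises⇒≅ L R))
  , [ (λ R → inj₂ (inj₁ (realises⇒≅ L R)))
    , [ (λ R → inj₂ (inj₂ (inj₁ (realises⇒≅ L R))))
      , [ (λ R → inj₂ (inj₂ (inj₂ (inj₁ (realises⇒≅ L R)))))
        , (λ (h , 2≤h , R) → inj₂ (inj₂ (inj₂ (inj₂ (h , 2≤h , realises⇒≅ L R))))) ]′ ]′ ]′ ]′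
  (classification S classify unmixed (index-of (vertex-surj v)) (fromPM L PM , fromPM-selects L PM))
  where
  open 𝔅 B
  PM = proj₂ hasPerfectMatching
  L = labelling G side sides PM
  open Labelling L
  S = setting L covered
  open Setting S using (One; Two; Selection; ∈ₛ-self)

  index-of : ∀ {u} → ∃ (λ x → vertex x ≡ u) → Fin n
  index-of (inj₁ i , _) = i
  index-of (inj₂ i , _) = i

  classify : ∀ e → One e ⊎ Two e
  classify e = Sum.map (ME₁⇒One L covered) (ME₂⇒Two L covered) (oneOrTwo e)

  -- `noMixing` speaks of `MatchingEdge`; asking `oneOrTwo` again recovers it from `One` and `Two`,
  -- which exclude each other.
  unmixed : ∀ {f u v} → Selection f → One (f u) → Two (f v) → ⊥
  unmixed {f} {u} {v} F o t with oneOrTwo (f u) | oneOrTwo (f v)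
  ... | inj₂ m₂ | _       = two⇒¬one S (ME₂⇒Two L covered m₂) o
  ... | inj₁ _  | inj₁ m₁ = two⇒¬one S t (ME₁⇒One L covered m₁)
  ... | inj₁ m₁ | inj₂ m₂ = noMixing (toPM L f) (toPM-perfect L F)
          (f u , f v , ∈-toPM⁺ L f (∈ₛ-self F u) , ∈-toPM⁺ L f (∈ₛ-self F v) , m₁ , m₂)

-- Transport of perfect matchings along isomorphisms.

≅-sym : ∀ {G H} → G ≅ H → H ≅ G
≅-sym {G} {H} i = record
  { onVertices = ↔-sym onVertices
  ; onEdges    = ↔-sym onEdges
  ; incidence  = λ v e → mk⇔
      (λ inc → Equivalence.from (incidence (V.from v) (E.from e))
         (subst₂ (Incident H) (sym (V.strictlyInverseˡ v)) (sym (E.strictlyInverseˡ e)) inc))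
      (λ inc → subst₂ (Incident H) (V.strictlyInverseˡ v) (E.strictlyInverseˡ e)
         (Equivalence.to (incidence (V.from v) (E.from e)) inc))
  }
  where
  open _≅_ i
  module V = Inverse onVertices
  module E = Inverse onEdges

module Transport {G H : Multigraph} (i : G ≅ H) where
  open _≅_ i
  private
    module V = Inverse onVertices
    module E = Inverse onEdges

  push : Subset (nE G) → Subset (nE H)
  push M = tabulate (λ e → Vec.lookup M (E.from e))

  push⁺ : ∀ {M e} → E.from e ∈ M → e ∈ push M
  push⁺ {M} {e} p = lookup⇒[]= e (push M) (trans (lookup∘tabulate _ e) ([]=⇒lookup p))

  push⁻ : ∀ {M e} → e ∈ push M → E.from e ∈ M
  push⁻ {M} {e} p = lookup⇒[]= (E.from e) M (trans (sym (lookup∘tabulate _ e)) ([]=⇒lookup p))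

  push-to : ∀ {M e} → e ∈ M → E.to e ∈ push M
  push-to {M} p = push⁺ (subst (_∈ M) (sym (E.strictlyInverseʳ _)) p)

  push-injective : ∀ {M N} → push M ≡ push N → M ≡ N
  push-injective eq = ⊆-antisym (half eq) (half (sym eq))
    where
    half : ∀ {M N} → push M ≡ push N → ∀ {e} → e ∈ M → e ∈ N
    half {N = N} eq p = subst (_∈ N) (E.strictlyInverseʳ _) (push⁻ (subst (_ ∈_) eq (push-to p)))

  push-perfect : ∀ {M} → PerfectMatching G M → PerfectMatching H (push M)
  push-perfect {M} PM v with e , (e∈M , inc) , unique ← PM (V.from v) =
    E.to e , (push-to e∈M , subst (λ u → Incident H u (E.to e)) (V.strictlyInverseˡ v)
                              (Equivalence.to (incidence (V.from v) e) inc))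
    , λ {f} (f∈ , incf) → trans (cong E.to (unique (push⁻ f∈ ,
        Equivalence.from (incidence (V.from v) (E.from f))
          (subst₂ (Incident H) (sym (V.strictlyInverseˡ v)) (sym (E.strictlyInverseˡ f)) incf))))
        (E.strictlyInverseˡ f)

module _ {G H : Multigraph} (i : G ≅ H) where
  private
    module E = Inverse (_≅_.onEdges i)
    module I = Transport i
    module J = Transport (≅-sym i)

    push-pull : ∀ N → I.push (J.push N) ≡ N
    push-pull N = ⊆-antisym
      (λ {e} p → subst (_∈ N) (E.strictlyInverseˡ e) (J.push⁻ {N} (I.push⁻ {J.push N} p)))
      (λ {e} p → I.push⁺ {J.push N} (J.push⁺ {N} (subst (_∈ N) (sym (E.strictlyInverseˡ e)) p)))

  matchingEdge-to : ∀ {k e} → MatchingEdge k G e → MatchingEdge k H (E.to e)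
  matchingEdge-to {e = e} (Ms , len , unique , lists) =
    map I.push Ms , trans (length-map I.push Ms) len , map⁺ I.push-injective unique , λ N → mk⇔ (to N) (from N)
    where
    to : ∀ N → N ∈ˡ map I.push Ms → PerfectMatching H N × E.to e ∈ N
    to N p with M , M∈ , refl ← ∈-map⁻ I.push p with PM , e∈M ← Equivalence.to (lists M) M∈ =
      I.push-perfect PM , I.push-to e∈M
    from : ∀ N → PerfectMatching H N × E.to e ∈ N → N ∈ˡ map I.push Ms
    from N (PN , e∈N) = subst (_∈ˡ map I.push Ms) (push-pull N) (∈-map⁺ I.push
      (Equivalence.from (lists (J.push N)) (J.push-perfect PN , J.push⁺ e∈N)))

-- Enumeration of perfect matchings.

subsets : ∀ n → List (Subset n)
subsets zero    = [] ∷ []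
subsets (suc n) = map (inside ∷_) (subsets n) ++ map (outside ∷_) (subsets n)

subsets-complete : ∀ {n} (M : Subset n) → M ∈ˡ subsets n
subsets-complete []            = here refl
subsets-complete (inside ∷ M)  = ∈-++⁺ˡ (∈-map⁺ (inside ∷_) (subsets-complete M))
subsets-complete (outside ∷ M) = ∈-++⁺ʳ _ (∈-map⁺ (outside ∷_) (subsets-complete M))

subsets-unique : ∀ n → Unique (subsets n)
subsets-unique zero    = [] ∷ []
subsets-unique (suc n) = ++⁺ (map⁺ ∷-injectiveʳ (subsets-unique n)) (map⁺ ∷-injectiveʳ (subsets-unique n)) disjoint
  where
  disjoint : ∀ {M} → ¬ (M ∈ˡ map (inside ∷_) (subsets n) × M ∈ˡ map (outside ∷_) (subsets n))
  disjoint (p , q) with _ , _ , refl ← ∈-map⁻ _ p with _ , _ , () ← ∈-map⁻ _ q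

∃!? : ∀ {n p} {P : Fin n → Set p} → Decidable P → Dec (∃! _≡_ P)
∃!? P? = map′ (λ (x , px , u) → x , px , u _) (λ (x , px , u) → x , px , λ _ → u)
  (any? λ x → P? x ×-dec all? λ y → P? y →-dec (x ≟ y))

module _ (G : Multigraph) where

  perfectMatching? : Decidable (PerfectMatching G)
  perfectMatching? M = all? λ v → ∃!? λ e →
    (e ∈? M) ×-dec ((v ≟ proj₁ (ends G e)) ⊎-dec (v ≟ proj₂ (ends G e)))

  -- Membership comes first, so that sets avoiding `e` are rejected before the costlier test.
  through? : ∀ e → Decidable (λ M → e ∈ M × PerfectMatching G M)
  through? e M = (e ∈? M) ×-dec perfectMatching? M

  matchingsThrough : Edge G → List (Subset (nE G))
  matchingsThrough e = filter (through? e) (subsets (nE G))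

  -- Turns the claim into a numerical equation that evaluation settles for a concrete graph.
  matchingEdge-count : ∀ {k} e → length (matchingsThrough e) ≡ k → MatchingEdge k G e
  matchingEdge-count e len = matchingsThrough e , len , filter⁺ (through? e) (subsets-unique (nE G)) ,
    λ M → mk⇔ (λ p → let e∈ , PM = proj₂ (∈-filter⁻ (through? e) {xs = subsets (nE G)} p) in PM , e∈)
               (λ (PM , e∈) → ∈-filter⁺ (through? e) (subsets-complete M) (e∈ , PM))

matchingEdge-from : ∀ {G H} (i : G ≅ H) {k e} →
                    MatchingEdge k H (Inverse.to (_≅_.onEdges i) e) → MatchingEdge k G e
matchingEdge-from {G} i {k} m =
  subst (MatchingEdge k G) (Inverse.strictlyInverseʳ (_≅_.onEdges i) _) (matchingEdge-to (≅-sym i) m)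

not-one-and-two : ∀ G {e} → MatchingEdge 1 G e → ¬ MatchingEdge 2 G e
not-one-and-two G (L ∷ [] , _ , _ , lists) (M ∷ N ∷ [] , _ , (M≢N ∷ []) ∷ _ , lists′) =
  M≢N (trans (is-L (here refl)) (sym (is-L (there (here refl)))))
  where
  is-L : ∀ {P} → P ∈ˡ (M ∷ N ∷ []) → P ≡ L
  is-L {P} p with here eq ← Equivalence.from (lists P) (Equivalence.to (lists′ P) p) = eq

perfect-meet : ∀ G {M} → PerfectMatching G M → ∀ v {e f} → e ∈ M → Incident G v e → f ∈ M → Incident G v f → e ≡ f
perfect-meet G PM v e∈ i f∈ j with _ , _ , unique ← PM v = trans (sym (unique (e∈ , i))) (unique (f∈ , j))

-- Listed graphs are in `𝔅`.

EdgeDetermined : Multigraph → Set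
EdgeDetermined G = ∀ {e M N} → PerfectMatching G M → PerfectMatching G N → e ∈ M → e ∈ N → M ≡ N

module _ {G : Multigraph} (covered : MatchingCovered G) where

  module _ {H : Multigraph} (i : G ≅ H) where
    private
      module E = Inverse (_≅_.onEdges i)
      open Transport i

    -- The edge of `H` is there to obtain a perfect matching: a single vertex without edges is
    -- matching covered vacuously, yet has none.
    𝔅-transport : Edge H → (∀ e → MatchingEdge 1 H e ⊎ MatchingEdge 2 H e) →
                  (∀ {M e f} → PerfectMatching H M → e ∈ M → f ∈ M →
                    MatchingEdge 1 H e → ¬ MatchingEdge 2 H f) → 𝔅 G
    𝔅-transport e₀ oneOrTwo unmixed = record
      { connected = proj₁ covered
      ; hasPerfectMatching = let M , PM , _ = proj₂ covered (E.from e₀) in M , PM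
      ; oneOrTwo = λ e → Sum.map (matchingEdge-from i) (matchingEdge-from i) (oneOrTwo (E.to e))
      ; noMixing = λ M PM (e , f , e∈ , f∈ , m₁ , m₂) →
          unmixed (push-perfect PM) (push-to e∈) (push-to f∈) (matchingEdge-to i m₁) (matchingEdge-to i m₂)
      }

    𝔅-edgeDetermined : Edge H → EdgeDetermined H → 𝔅 G
    𝔅-edgeDetermined e₀ determined = record
      { connected = proj₁ covered
      ; hasPerfectMatching = let M , PM , _ = proj₂ covered (E.from e₀) in M , PM
      ; oneOrTwo = inj₁ ∘ one
      ; noMixing = λ _ _ (_ , f , _ , _ , _ , m₂) → not-one-and-two G (one f) m₂
      }
      where
      one : ∀ e → MatchingEdge 1 G e
      one e with M , PM , e∈M ← proj₂ covered e = M ∷ [] , refl , [] ∷ [] , λ N → mk⇔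
        (λ { (here refl) → PM , e∈M })
        (λ (PN , e∈N) → here (push-injective (determined (push-perfect PN) (push-perfect PM) (push-to e∈N) (push-to e∈M))))

K₂*-determined : ∀ m → EdgeDetermined (K₂* m)
K₂*-determined m {e} PM PN e∈M e∈N = ⊆-antisym (only PM PN e∈M e∈N) (only PN PM e∈N e∈M)
  where
  only : ∀ {M N} → PerfectMatching (K₂* m) M → PerfectMatching (K₂* m) N → e ∈ M → e ∈ N → ∀ {f} → f ∈ M → f ∈ N
  only {N = N} PM _ e∈M e∈N f∈M =
    subst (_∈ N) (perfect-meet (K₂* m) PM 0F e∈M (inj₁ refl) f∈M (inj₁ refl)) e∈N

module _ {k : ℕ} .{{_ : NonZero k}} where

  next-injective : ∀ {i j : Fin k} → next i ≡ next j → i ≡ j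
  next-injective {i} {j} eq with toℕ-next i | toℕ-next j
  ... | inj₁ (_ , p) | inj₁ (_ , q) = toℕ-injective (suc-injective (trans (sym p) (trans (cong toℕ eq) q)))
  ... | inj₂ (p , _) | inj₂ (q , _) = toℕ-injective (suc-injective (trans p (sym q)))
  ... | inj₁ (_ , p) | inj₂ (_ , q) with () ← trans (sym p) (trans (cong toℕ eq) q)
  ... | inj₂ (_ , p) | inj₁ (_ , q) with () ← trans (sym q) (trans (cong toℕ (sym eq)) p)

  -- Walk down from `i` to 0 and up again to `j`; the step that wraps around is avoided.
  next-connects : ∀ {p} (P : Fin k → Set p) → (∀ {i} → P i → P (next i)) → (∀ {i} → P (next i) → P i) →
                  ∀ {i} j → P i → P j
  next-connects P forth back {i} j p = up (toℕ j) refl (λ z≡ → down (toℕ i) refl p z≡)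
    where
    previous : ∀ {t} (i : Fin k) → toℕ i ≡ suc t → ∃ λ h → toℕ h ≡ t × next h ≡ i
    previous {t} i eq = h , h≡ , toℕ-injective (next-h (toℕ-next h))
      where
      t<k : suc t < k
      t<k = subst (_< k) eq (toℕ<n i)
      h : Fin k
      h = fromℕ< (<-trans (n<1+n t) t<k)
      h≡ : toℕ h ≡ t
      h≡ = toℕ-fromℕ< _
      next-h : _ → toℕ (next h) ≡ toℕ i
      next-h (inj₁ (_ , q)) = trans q (trans (cong suc h≡) (sym eq))
      next-h (inj₂ (q , _)) = contradiction (trans (cong suc (sym h≡)) q) (<⇒≢ t<k)

    down : ∀ t {i z} → toℕ i ≡ t → P i → toℕ z ≡ 0 → P z
    down zero    eq p z≡ = subst P (toℕ-injective (trans eq (sym z≡))) p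
    down (suc t) {i} eq p z≡ with h , h≡ , refl ← previous i eq = down t h≡ (back p) z≡

    up : ∀ t {j} → toℕ j ≡ t → (∀ {z} → toℕ z ≡ 0 → P z) → P j
    up zero    eq p = p eq
    up (suc t) {j} eq p with h , h≡ , refl ← previous j eq = forth (up t h≡ p)

-- The vertex `next i` meets just the edges `i` and `next i`, so membership in a perfect matching
-- alternates around the cycle and is fixed by its value at one edge.
Cycle-determined : ∀ k (2≤k : 2 ≤ k) → EdgeDetermined (Cycle k 2≤k)
Cycle-determined k 2≤k {e₀} {M} {N} PM PN e∈M e∈N = ⊆-antisym (proj₁ (agree _)) (proj₂ (agree _))
  where
  instance
    k≢0 : NonZero k
    k≢0 = >-nonZero (≤-trans (s≤s z≤n) 2≤k)

  C : Multigraph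
  C = Cycle k 2≤k

  covers : ∀ {L} → PerfectMatching C L → ∀ i → i ∈ L ⊎ next i ∈ L
  covers {L} PL i with PL (next i)
  ... | e , (e∈L , inj₁ eq) , _ = inj₂ (subst (_∈ L) (sym eq) e∈L)
  ... | e , (e∈L , inj₂ eq) , _ = inj₁ (subst (_∈ L) (sym (next-injective eq)) e∈L)

  excludes : ∀ {L} → PerfectMatching C L → ∀ i → i ∈ L → ¬ next i ∈ L
  excludes PL i i∈ next∈ =
    next-≢ 2≤k i (perfect-meet C PL (next i) i∈ (inj₂ refl) next∈ (inj₁ refl))

  forth : ∀ {L L′} → PerfectMatching C L → PerfectMatching C L′ → ∀ {i} → (i ∈ L′ → i ∈ L) → next i ∈ L → next i ∈ L′
  forth PL PL′ {i} sub next∈ with covers PL′ i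
  ... | inj₁ i∈ = contradiction next∈ (excludes PL i (sub i∈))
  ... | inj₂ n∈ = n∈

  back : ∀ {L L′} → PerfectMatching C L → PerfectMatching C L′ → ∀ {i} → (next i ∈ L′ → next i ∈ L) → i ∈ L → i ∈ L′
  back PL PL′ {i} sub i∈ with covers PL′ i
  ... | inj₁ i∈′ = i∈′
  ... | inj₂ n∈  = contradiction (sub n∈) (excludes PL i i∈)

  -- Passing to the adjacent edge swaps the roles of `M` and `N` in an implication, so both
  -- directions travel together.
  agree : ∀ j → (j ∈ M → j ∈ N) × (j ∈ N → j ∈ M)
  agree j = next-connects (λ j → (j ∈ M → j ∈ N) × (j ∈ N → j ∈ M))
    (λ (p , q) → forth PM PN q , forth PN PM p)
    (λ (p , q) → back PM PN q , back PN PM p)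
    j ((λ _ → e∈N) , (λ _ → e∈M))

C₄⁴-two : ∀ e → MatchingEdge 2 C₄⁴ e
C₄⁴-two e = matchingEdge-count C₄⁴ e (from-yes (all? λ e → length (matchingsThrough C₄⁴ e) ℕ.≟ 2) e)

K₃₃-two : ∀ e → MatchingEdge 2 (K 3 3) e
K₃₃-two e = matchingEdge-count (K 3 3) e (from-yes (all? λ e → length (matchingsThrough (K 3 3) e) ℕ.≟ 2) e)

C₄²-oneOrTwo : ∀ e → MatchingEdge 1 C₄² e ⊎ MatchingEdge 2 C₄² e
C₄²-oneOrTwo 0F = inj₂ (matchingEdge-count C₄² 0F refl)
C₄²-oneOrTwo 1F = inj₂ (matchingEdge-count C₄² 1F refl)
C₄²-oneOrTwo 2F = inj₁ (matchingEdge-count C₄² 2F refl)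
C₄²-oneOrTwo 3F = inj₂ (matchingEdge-count C₄² 3F refl)
C₄²-oneOrTwo 4F = inj₂ (matchingEdge-count C₄² 4F refl)
C₄²-oneOrTwo 5F = inj₁ (matchingEdge-count C₄² 5F refl)

-- The counts leave `e` simple and `f` doubled, and in `C₄²` any two such edges share a vertex.
C₄²-unmixed : ∀ {M e f} → PerfectMatching C₄² M → e ∈ M → f ∈ M → MatchingEdge 1 C₄² e → ¬ MatchingEdge 2 C₄² f
C₄²-unmixed {M} {e} {f} PM e∈ f∈ m₁ m₂ with e | f
... | 0F | _  = not-one-and-two C₄² m₁ (matchingEdge-count C₄² 0F refl)
... | 1F | _  = not-one-and-two C₄² m₁ (matchingEdge-count C₄² 1F refl)
... | 3F | _  = not-one-and-two C₄² m₁ (matchingEdge-count C₄² 3F refl)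
... | 4F | _  = not-one-and-two C₄² m₁ (matchingEdge-count C₄² 4F refl)
... | _  | 2F = not-one-and-two C₄² (matchingEdge-count C₄² 2F refl) m₂
... | _  | 5F = not-one-and-two C₄² (matchingEdge-count C₄² 5F refl) m₂
... | 2F | 0F with () ← perfect-meet C₄² PM 1F e∈ (inj₁ refl) f∈ (inj₂ refl)
... | 2F | 1F with () ← perfect-meet C₄² PM 1F e∈ (inj₁ refl) f∈ (inj₂ refl)
... | 2F | 3F with () ← perfect-meet C₄² PM 2F e∈ (inj₂ refl) f∈ (inj₁ refl)
... | 2F | 4F with () ← perfect-meet C₄² PM 2F e∈ (inj₂ refl) f∈ (inj₁ refl)
... | 5F | 0F with () ← perfect-meet C₄² PM 0F e∈ (inj₂ refl) f∈ (inj₁ refl)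
... | 5F | 1F with () ← perfect-meet C₄² PM 0F e∈ (inj₂ refl) f∈ (inj₁ refl)
... | 5F | 3F with () ← perfect-meet C₄² PM 3F e∈ (inj₁ refl) f∈ (inj₂ refl)
... | 5F | 4F with () ← perfect-meet C₄² PM 3F e∈ (inj₁ refl) f∈ (inj₂ refl)

listed⇒𝔅 : ∀ {G} → MatchingCovered G → Listed G → 𝔅 G
listed⇒𝔅 covered (inj₁ (suc m , _ , i)) = 𝔅-edgeDetermined covered i zero (K₂*-determined (suc m))
listed⇒𝔅 covered (inj₂ (inj₁ i)) = 𝔅-transport covered i zero C₄²-oneOrTwo C₄²-unmixed
listed⇒𝔅 covered (inj₂ (inj₂ (inj₁ i))) =
  𝔅-transport covered i zero (inj₂ ∘ C₄⁴-two) λ {_} {e} _ _ _ m₁ _ → not-one-and-two C₄⁴ m₁ (C₄⁴-two e)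
listed⇒𝔅 covered (inj₂ (inj₂ (inj₂ (inj₁ i)))) =
  𝔅-transport covered i zero (inj₂ ∘ K₃₃-two) λ {_} {e} _ _ _ m₁ _ → not-one-and-two (K 3 3) m₁ (K₃₃-two e)
listed⇒𝔅 covered (inj₂ (inj₂ (inj₂ (inj₂ (suc n , 2≤n , i))))) =
  𝔅-edgeDetermined covered i zero (Cycle-determined (2 * suc n) (≤-trans 2≤n (m≤m+n (suc n) (suc n + 0))))

theorem1p6 : (G : Multigraph) → Bipartite G → MatchingCovered G →
    𝔅 G ⇔
    ( (∃ λ m → 1 ≤ m × G ≅ K₂* m)
    ⊎ G ≅ C₄²
    ⊎ G ≅ C₄⁴
    ⊎ G ≅ K 3 3
    ⊎ (∃ λ n → ∃ λ (2≤n : 2 ≤ n) → G ≅ EvenCycle n 2≤n) )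
theorem1p6 G bipartite covered = mk⇔ (𝔅⇒listed bipartite covered) (listed⇒𝔅 covered)
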